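{- For every $n\ge 4$, the number of smooth arithmetical structures on $D_n$ satisfies \[ \frac{1}{24}(n^3-3n^2-n-45)\leq \lvert\operatorname{SArith}(D_n)\rvert<\frac{2}{3}n^3-2n^2+\frac{16}{3}n-6+(2n^2-4n+2)\log(n-3), \] where $\log$ is the natural logarithm.
   Context: For $n\ge 3$ let $\ell=n-3$. The bident $D_n$ is the graph with vertices $v_x,v_y,v_0,v_1,\dots,v_\ell$ and edges $v_xv_0$, $v_yv_0$, and $v_iv_{i+1}$ for $0\le i\le \ell-1$. For a finite connected graph $G$ with adjacency matrix $A$, an arithmetical structure on $G$ is a pair $(\mathbf d,\mathbf r)$ of vectors with positive integer entries indexed by the vertices such that $(\operatorname{diag}(\mathbf d)-A)\mathbf r=\mathbf 0$ and the entries of $\mathbf r$ have no nontrivial common factor. On $D_n$ write $\mathbf d=(d_x,d_y,d_0,\dots,d_\ell)$. An arithmetical structure on $D_n$ is smooth if $d_x,d_y,d_1,\dots,d_\ell\ge 2$; $\operatorname{SArith}(D_n)$ is the set of smooth arithmetical structures on $D_n$. -}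

module Defs where

open import Data.Nat as ℕ using (ℕ; zero; suc; _≡ᵇ_; _∸_)
open import Data.Nat.Divisibility using (_∣_)
open import Data.Bool using (if_then_else_; _∨_)
open import Data.Fin using (Fin; toℕ)
open import Data.Vec using (Vec; lookup; tabulate; sum)
open import Data.Product using (_×_; _,_; proj₁)
open import Data.Integer using (+_)
open import Data.Rational.Unnormalised as Q using (ℚᵘ; _/_; 0ℚᵘ)
open import Relation.Binary.PropositionalEquality using (_≡_; _≢_)

-- The bident D_n, with vertex set Fin n (n ≥ 3), indexed as
--   0 ↦ v_x ,  1 ↦ v_y ,  2 + i ↦ v_i   (0 ≤ i ≤ ℓ = n - 3).
-- Edges: v_x v_0, v_y v_0, v_i v_{i+1}.
-- bidentAdjℕ a b is the (a,b) entry of the adjacency matrix (0 or 1).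

bidentAdjℕ : ℕ → ℕ → ℕ
bidentAdjℕ (suc (suc a)) (suc (suc b)) =
  if (b ≡ᵇ suc a) ∨ (a ≡ᵇ suc b) then 1 else 0
bidentAdjℕ 0 2 = 1
bidentAdjℕ 2 0 = 1
bidentAdjℕ 1 2 = 1
bidentAdjℕ 2 1 = 1
bidentAdjℕ _ _ = 0

bidentAdj : (n : ℕ) → Fin n → Fin n → ℕ
bidentAdj n i j = bidentAdjℕ (toℕ i) (toℕ j)

-- Arithmetical structures on a graph with adjacency matrix A : Fin n → Fin n → ℕ.
-- (diag(d) - A) r = 0  ⇔  for every vertex i,  d_i r_i = Σ_j A_ij r_j.

IsArithmetical : (n : ℕ) → (Fin n → Fin n → ℕ) → Vec ℕ n × Vec ℕ n → Set
IsArithmetical n A (d , r) =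
  (∀ i → 0 ℕ.< lookup d i) ×
  (∀ i → 0 ℕ.< lookup r i) ×
  (∀ i → lookup d i ℕ.* lookup r i ≡ sum (tabulate (λ j → A i j ℕ.* lookup r j))) ×
  (∀ k → (∀ i → k ∣ lookup r i) → k ≡ 1)

-- Smooth arithmetical structures on D_n: d_x, d_y, d_1, …, d_ℓ ≥ 2,
-- i.e. d at every vertex other than v_0 (index 2) is at least 2.
IsSmoothArith : (n : ℕ) → Vec ℕ n × Vec ℕ n → Set
IsSmoothArith n dr =
  IsArithmetical n (bidentAdj n) dr ×
  (∀ i → toℕ i ≢ 2 → 2 ℕ.≤ lookup (proj₁ dr) i)

-- Natural logarithm, via its definition log m = ∫_1^m dt/t (m ≥ 1).
-- logLowerSum m K (K ≥ 1) is the lower Riemann sum of 1/t over [1,m] for the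
-- uniform partition into K pieces of width h = (m-1)/K:
--   Σ_{j=1}^{K} h / (1 + j h) = Σ_{j=1}^{K} (m-1) / (K + j (m-1)).
-- These sums are ≤ log m and converge to log m as K → ∞, so
--   x < a + b log m  (b > 0)  ⇔  ∃ K ≥ 1. x < a + b · logLowerSum m K.

logLowerSumAux : (m k J : ℕ) → ℚᵘ
logLowerSumAux m k zero = 0ℚᵘ
logLowerSumAux m k (suc J) =
  logLowerSumAux m k J Q.+ ((+ (m ∸ 1)) / (suc k ℕ.+ suc J ℕ.* (m ∸ 1)))

-- lower sum with K = suc k pieces
logLowerSum : (m k : ℕ) → ℚᵘ
logLowerSum m k = logLowerSumAux m k (suc k)

ℕ→ℚ : ℕ → ℚᵘ
ℕ→ℚ n = + n / 1

lowerBound : ℕ → ℚᵘ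
lowerBound n = (+ 1 / 24) Q.* (N Q.* N Q.* N Q.- ℕ→ℚ 3 Q.* N Q.* N Q.- N Q.- ℕ→ℚ 45)
  where N = ℕ→ℚ n

upperPoly : ℕ → ℚᵘ
upperPoly n = (+ 2 / 3) Q.* N Q.* N Q.* N Q.- ℕ→ℚ 2 Q.* N Q.* N Q.+ (+ 16 / 3) Q.* N Q.- ℕ→ℚ 6
  where N = ℕ→ℚ n

upperLogCoeff : ℕ → ℚᵘ
upperLogCoeff n = ℕ→ℚ 2 Q.* N Q.* N Q.- ℕ→ℚ 4 Q.* N Q.+ ℕ→ℚ 2
  where N = ℕ→ℚ n

{-# OPTIONS --safe #-}

-- On a smooth structure r decreases along the path, which forces d₀ = 1, so the structure is
-- determined by (a, b) = (d_x, d_y): up to scale r_x, r_y, r₀ are b, a, ab, and r₁ = ab - a - b.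
-- The path is then a Hirzebruch-Jung continued fraction, and its length is one more than the number
-- A of steps (x, y) ↦ (x - y, y) in the subtractive Euclidean algorithm started at (ab - a - b, a + b).
--
-- Upper bound.  A strictly increases under b ↦ b + a², so a given a admits at most a² values of b;
-- this is used for a ≤ M = n - 2 and, symmetrically, for b ≤ M.  Otherwise ab ≤ M (a + b), that is
-- (a - M)(b - M) ≤ M², and the lattice points under this hyperbola give the harmonic sum that is
-- compared with the logarithm.
--
-- Lower bound.  If the algorithm started at (x, y) makes A steps of the first and B of the second
-- kind, then (A + 1)(B + 1) < x + y.  With x + y = a², one of the residues ±x mod a² therefore has
-- A + 1 < a.  When 2a ≤ n, a value of b in that class can be moved by multiples of a² to reach the
-- exact length n - 3, since A grows by 1 with each shift once a + b > a².
module Submission where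

open import Defs
open import Data.Bool using (Bool; true; false)
open import Data.Fin using (Fin; toℕ; zero; suc)
open import Data.Fin.Properties using (injective⇒≤)
open import Data.List using (List; []; _∷_; _++_; length; map; upTo; lookup; cartesianProduct)
open import Data.List.Properties using (++-identityʳ; length-map; length-++; length-upTo)
open import Data.List.Membership.Propositional using (_∈_; lose)
open import Data.List.Membership.Propositional.Properties using (∈-map⁺; ∈-map⁻; ∈-++⁺ˡ; ∈-++⁺ʳ; ∈-++⁻; ∈-upTo⁺; ∈-upTo⁻; ∈-lookup; ∈-cartesianProduct⁺; ∈-cartesianProduct⁻)
open import Data.List.Relation.Binary.Pointwise using (Pointwise; []; _∷_; Pointwise-length)
open import Data.List.Relation.Unary.All as All using (All; []; _∷_)
open import Data.List.Relation.Unary.AllPairs using ([]; _∷_)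
open import Data.List.Relation.Unary.Any as Any using (Any; here; there)
open import Data.List.Relation.Unary.Any.Properties using (lookup-index)
open import Data.List.Relation.Unary.Unique.Propositional using (Unique)
import Data.List.Relation.Unary.Unique.Propositional.Properties as Unique
open import Data.Nat as ℕ using (ℕ; zero; suc; _∸_; _≤_; z≤n; s≤s)
open import Data.Nat.Coprimality using (Coprime; coprime-divisor; coprime⇒gcd≡1; gcd≡1⇒coprime)
open import Data.Nat.DivMod using (m/n*n≤m; m*n/n≡m; n/1≡n; /-monoˡ-≤; m≡m%n+[m/n]*n; [m+kn]%n≡m%n; m<n⇒m%n≡m; m%n<n)
open import Data.Nat.Divisibility using (_∣_; divides; ∣m⇒∣m*n; ∣n⇒∣m*n; ∣m+n∣m⇒∣n; ∣m∣n⇒∣m+n; ∣-refl)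
open import Data.Nat.GCD using (gcd; gcd[m,n]∣m; gcd[m,n]∣n; c*gcd[m,n]≡gcd[cm,cn]; gcd-comm)
open import Data.Nat.Induction using (<-wellFounded)
import Data.Nat.Properties as ℕₚ
open import Data.Nat.Tactic.RingSolver using (solve-∀)
open import Data.Product using (_×_; _,_; ∃-syntax; proj₁; proj₂; swap)
open import Data.Sum using (_⊎_; inj₁; inj₂; [_,_]′)
open import Data.Vec as Vec using (Vec; []; _∷_; sum; tabulate)
open import Induction.WellFounded using (Acc; acc)
open import Relation.Binary.Definitions using (tri<; tri≈; tri>)
open import Relation.Binary.PropositionalEquality
open import Relation.Nullary using (contradiction; yes; no)

module Counting where

  open import Data.Nat using (_+_; _*_; _/_; _%_; _⊓_; _<_; z<s; _≤?_; >-nonZero; ≤-pred)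
  open import Data.Nat.Properties

  private variable
    A C : Set

  -- The subtractive Euclidean algorithm

  -- Steps x y A B: from (x, y) it reaches a pair (g, g) after A subtractions x - y and B
  -- subtractions y - x.
  data Steps : ℕ → ℕ → ℕ → ℕ → Set where
    done  : ∀ {g} → 0 < g → Steps g g 0 0
    left  : ∀ {x y A B} → Steps x y A B → Steps (x + y) y (suc A) B
    right : ∀ {x y A B} → Steps x y A B → Steps x (x + y) A (suc B)

  castˡ : ∀ {x x′ y A B} → x ≡ x′ → Steps x y A B → Steps x′ y A B
  castˡ refl s = s

  castʳ : ∀ {x y y′ A B} → y ≡ y′ → Steps x y A B → Steps x y′ A B
  castʳ refl s = s

  positiveˡ : ∀ {x y A B} → Steps x y A B → 0 < x
  positiveˡ (done 0<g)        = 0<g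
  positiveˡ (left {x} {y} s)  = <-≤-trans (positiveˡ s) (m≤m+n x y)
  positiveˡ (right s)         = positiveˡ s

  swapSteps : ∀ {x y A B} → Steps x y A B → Steps y x B A
  swapSteps (done 0<g)        = done 0<g
  swapSteps (left {x} {y} s)  = castʳ (+-comm y x) (right (swapSteps s))
  swapSteps (right {x} {y} s) = castˡ (+-comm y x) (left (swapSteps s))

  positiveʳ : ∀ {x y A B} → Steps x y A B → 0 < y
  positiveʳ s = positiveˡ (swapSteps s)

  scaleSteps : ∀ {x y A B} g → 0 < g → Steps x y A B → Steps (g * x) (g * y) A B
  scaleSteps g 0<g (done 0<h)        = done (*-mono-< 0<g 0<h)
  scaleSteps g 0<g (left {x} {y} s)  =
    castˡ (sym (*-distribˡ-+ g x y)) (left (scaleSteps g 0<g s))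
  scaleSteps g 0<g (right {x} {y} s) =
    castʳ (sym (*-distribˡ-+ g x y)) (right (scaleSteps g 0<g s))

  lefts : ∀ {x y A B} k → Steps x y A B → Steps (k * y + x) y (k + A) B
  lefts zero s = s
  lefts {x} {y} (suc k) s =
    castˡ (trans (+-comm _ y) (sym (+-assoc y (k * y) x))) (left (lefts k s))

  rights : ∀ {x y A B} k → Steps x y A B → Steps x (k * x + y) A (k + B)
  rights k s = swapSteps (lefts k (swapSteps s))

  m+n≢n : ∀ {m n} → 0 < m → m + n ≢ n
  m+n≢n {m} {n} 0<m eq = <-irrefl (sym eq) (m<n+m n 0<m)

  -- After a `left` the first number is the larger one, after a `right` the second is. The pairs are
  -- compared through equations because sums in index position do not unify.
  left≢right : ∀ {x y A B x′ y′ A′ B′} → Steps x y A B → Steps x′ y′ A′ B′ →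
               x + y ≡ x′ → y ≢ x′ + y′
  left≢right {x} {y} {y′ = y′} s t refl f =
    m+n≢n (<-≤-trans (positiveˡ s) (m≤m+n x y′)) (trans (rearrange x y y′) (sym f))
    where
    rearrange : ∀ x y z → x + z + y ≡ x + y + z
    rearrange = solve-∀

  steps-det : ∀ {x y A B x′ y′ A′ B′} → Steps x y A B → Steps x′ y′ A′ B′ →
              x ≡ x′ → y ≡ y′ → A ≡ A′
  steps-det (done _) (done _) _ _ = refl
  steps-det (done _) (left t) e f = contradiction (trans (sym e) f) (m+n≢n (positiveˡ t))
  steps-det (done _) (right {x} {y} t) e f =
    contradiction (trans (+-comm y x) (trans (sym f) e)) (m+n≢n (positiveʳ t))
  steps-det (left s) (done _) e f = contradiction (trans e (sym f)) (m+n≢n (positiveˡ s))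
  steps-det (left {x} {y} s) (left {x′} t) e refl = cong suc (steps-det s t (+-cancelʳ-≡ y x x′ e) refl)
  steps-det (left s) (right t) e f = contradiction f (left≢right s t e)
  steps-det (right {x} {y} s) (done _) e f =
    contradiction (trans (+-comm y x) (trans f (sym e))) (m+n≢n (positiveʳ s))
  steps-det (right s) (left t) e f = contradiction (sym f) (left≢right t s (sym e))
  steps-det (right {x} {y} s) (right {y = y′} t) refl f = steps-det s t refl (+-cancelˡ-≡ x y y′ f)

  steps-total : ∀ x y → 0 < x → 0 < y → ∃[ A ] ∃[ B ] Steps x y A B
  steps-total x y = go x y (<-wellFounded (x + y))
    where
    go : ∀ x y → Acc _<_ (x + y) → 0 < x → 0 < y → ∃[ A ] ∃[ B ] Steps x y A B
    go x y (acc rs) 0<x 0<y with <-cmp x y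
    ... | tri≈ _ refl _ = _ , _ , done 0<x
    ... | tri< x<y _ _ =
          let eq = m+[n∸m]≡n (<⇒≤ x<y)
              A , B , s = go x (y ∸ x) (rs (subst (_< x + y) (sym eq) (m<n+m y 0<x))) 0<x (m<n⇒0<n∸m x<y)
          in  A , suc B , castʳ eq (right s)
    ... | tri> _ _ y<x =
          let eq = m∸n+n≡m (<⇒≤ y<x)
              A , B , s = go (x ∸ y) y (rs (subst (_< x + y) (sym eq) (m<m+n x 0<y))) (m<n⇒0<n∸m y<x) 0<y
          in  suc A , B , castˡ eq (left s)

  -- The run from `(x, y)` scales to a run from `(g x, g y)`, and `steps-det` identifies the two
  -- left counts.
  descaleSteps : ∀ {x y A B} g → 0 < g → Steps (g * x) (g * y) A B → ∃[ B′ ] Steps x y A B′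
  descaleSteps {x} {y} {A} g 0<g s =
    let A′ , B′ , t = steps-total x y (pos x (positiveˡ s)) (pos y (positiveʳ s))
    in  B′ , subst (λ z → Steps x y z B′) (sym (steps-det s (scaleSteps g 0<g t) refl refl)) t
    where
    pos : ∀ z → 0 < g * z → 0 < z
    pos zero    0<gz = contradiction (subst (0 <_) (*-zeroʳ g) 0<gz) (<-irrefl refl)
    pos (suc _) _    = s≤s z≤n

  -- A subtraction `x - y` removes at most the initial `y`, because the second number never grows,
  -- and the first number left at the end is at most `y` as well.
  steps-≤ : ∀ {x y A B} → Steps x y A B → x ≤ suc A * y
  steps-≤ (done {g} _) = ≤-reflexive (sym (*-identityˡ g))
  steps-≤ (left {x} {y} s) = ≤-trans (≤-reflexive (+-comm x y)) (+-monoʳ-≤ y (steps-≤ s))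
  steps-≤ (right {x} {y} {A} s) = ≤-trans (m≤m+n x y) (m≤m+n (x + y) (A * (x + y)))

  steps-<ˡ : ∀ {x y A B} → Steps x y A B → A < x
  steps-<ˡ (done 0<g)             = 0<g
  steps-<ˡ (left {x} {y} {A} s)   =
    ≤-trans (≤-reflexive (+-comm 1 (suc A))) (+-mono-≤ (steps-<ˡ s) (positiveʳ s))
  steps-<ˡ (right s)              = steps-<ˡ s

  -- A `left` adds `suc B` to the product and `y` to the sum, and `B < y` by `steps-<ˡ` with the
  -- coordinates exchanged; `right` is symmetric.
  steps-product : ∀ {x y A B} → Steps x y A B → suc A * suc B < x + y
  steps-product (done 0<g) = +-mono-≤ 0<g 0<g
  steps-product (left {x} {y} {A} {B} s) =
    <-≤-trans (+-mono-≤-< (steps-<ˡ (swapSteps s)) (steps-product s)) (≤-reflexive (+-comm y (x + y)))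
  steps-product (right {x} {y} {A} {B} s) =
    subst (_< x + (x + y)) (sym (*-suc (suc A) (suc B))) (+-mono-≤-< (steps-<ˡ s) (steps-product s))

  -- For x = a + b, y = a² and c = a - 1 the pair (c x - y, x) is (ab - a - b, a + b), while (x, y)
  -- is reached from the pair of (a, b + a²).
  steps-reflect : ∀ {x y A B} c z → Steps x y A B → 0 < z → z + y ≡ c * x →
                  ∃[ A′ ] ∃[ B′ ] (Steps z x A′ B′ × 2 + A′ ≤ c + A)
  steps-reflect {x} c z (done 0<g) 0<z e with c
  ... | zero = contradiction e (λ eq → <-irrefl (sym eq) (<-≤-trans 0<z (m≤m+n z x)))
  ... | suc zero = contradiction (trans e (*-identityˡ x)) (m+n≢n 0<z)
  ... | suc (suc c′) = c′ + 0 , 0 , castˡ eq (lefts c′ (done 0<g)) , ≤-refl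
    where
    eq : c′ * x + x ≡ z
    eq = +-cancelʳ-≡ x (c′ * x + x) z (trans (arith c′ x) (sym e))
      where
      arith : ∀ c x → c * x + x + x ≡ (2 + c) * x
      arith = solve-∀
  steps-reflect zero z (left {x} {y} s) 0<z e =
    contradiction e (λ eq → <-irrefl (sym eq) (<-≤-trans 0<z (m≤m+n z y)))
  -- Here `z = c (x + y) + x`, so `c` left steps and one right step lead from `(z, x + y)` to
  -- `(x, y)`.
  steps-reflect (suc c) z (left {x} {y} {A} s) 0<z e =
    c + A , _ , castˡ eq (lefts c (right s)) ,
    s≤s (≤-reflexive (sym (+-suc c A)))
    where
    eq : c * (x + y) + x ≡ z
    eq = +-cancelʳ-≡ y _ z (trans (arith c x y) (sym e))
      where
      arith : ∀ c x y → c * (x + y) + x + y ≡ (1 + c) * (x + y)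
      arith = solve-∀
  steps-reflect zero z (right {x} {y} s) 0<z e =
    contradiction e (λ eq → <-irrefl (sym eq) (<-≤-trans 0<z (m≤m+n z (x + y))))
  -- Cancelling `x` leaves `z + y = c x`, the hypothesis for the shorter run: a right step costs one
  -- unit of `c`.
  steps-reflect (suc c) z (right {x} {y} s) 0<z e =
    let A′ , B′ , t , le = steps-reflect c z s 0<z (+-cancelˡ-≡ x (z + y) (c * x) (trans (arith x z y) e))
    in  A′ , B′ , t , m≤n⇒m≤1+n le
    where
    arith : ∀ x z y → x + (z + y) ≡ z + (x + y)
    arith = solve-∀

  -- The pairs (d_x, d_y) of a smooth structure

  -- Tail a b p: the weights a, b at the prongs leave a path with p + 1 vertices besides v₀.
  record Tail (a b p : ℕ) : Set where
    constructor tail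
    field
      {X B} : ℕ
      total : X + (a + b) ≡ a * b
      steps : Steps X (a + b) p B

  tail-sym : ∀ {a b p} → Tail a b p → Tail b a p
  tail-sym {a} {b} (tail {X} e s) =
    tail (trans (cong (X +_) (+-comm b a)) (trans e (*-comm a b))) (castʳ (+-comm a b) s)

  tail-det : ∀ {a b p p′} → Tail a b p → Tail a b p′ → p ≡ p′
  tail-det {a} {b} (tail {X} e s) (tail {X′} e′ s′) =
    steps-det s s′ (+-cancelʳ-≡ (a + b) X X′ (trans e (sym e′))) refl

  -- Adding `a + b` to the bound `X ≤ (1 + p)(a + b)` gives the hyperbola that confines the pairs
  -- with both weights above `2 + p`.
  tail-≤ : ∀ {a b p} → Tail a b p → a * b ≤ (2 + p) * (a + b)
  tail-≤ {a} {b} {p} (tail {X} e s) =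
    ≤-trans (≤-reflexive (trans (sym e) (+-comm X (a + b)))) (+-monoʳ-≤ (a + b) (steps-≤ s))

  -- Both lengths are compared with the left count `A` of `(a + b, a²)`. The pair of `(a, b + a²)`
  -- reaches `(a + b, a²)` by `i` left steps and a right step, so the new length is `i + A`;
  -- `steps-reflect` with `c = a - 1` bounds the old one by `i + A - 1`.
  tail-+a² : ∀ {i b p} (let a = 2 + i) → Tail a b p → ∃[ p′ ] (p < p′ × Tail a (b + a * a) p′)
  tail-+a² {i} {b} {p} (tail {X} e s) =
    let a = 2 + i
        A , B , t = steps-total (a + b) (a * a) z<s z<s
        p″ , _ , t′ , le = steps-reflect (1 + i) X t (positiveˡ s) (+-cancelʳ-≡ (a + b) _ _ (reflected i b X e))
    in  i + A ,
        ≤-pred (subst (λ q → 2 + q ≤ 1 + i + A) (steps-det t′ s refl refl) le) ,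
        tail (arith i b) (castʳ (+-assoc a b (a * a)) (lefts i (right t)))
    where
    reflected : ∀ i b X → X + (2 + i + b) ≡ (2 + i) * b →
                X + (2 + i) * (2 + i) + (2 + i + b) ≡ (1 + i) * (2 + i + b) + (2 + i + b)
    reflected i b X e = trans (exchange X ((2 + i) * (2 + i)) (2 + i + b)) (trans (cong (_+ (2 + i) * (2 + i)) e) (expand i b))
      where
      exchange : ∀ x y z → x + y + z ≡ x + z + y
      exchange = solve-∀
      expand : ∀ i b → (2 + i) * b + (2 + i) * (2 + i) ≡ (1 + i) * (2 + i + b) + (2 + i + b)
      expand = solve-∀
    arith : ∀ i b → i * (2 + i + b + (2 + i) * (2 + i)) + (2 + i + b) + (2 + i + (b + (2 + i) * (2 + i)))
                  ≡ (2 + i) * (b + (2 + i) * (2 + i))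
    arith = solve-∀

  tail-+ka² : ∀ {i b p} k (let a = 2 + i) → Tail a b p → ∃[ p′ ] (k + p ≤ p′ × Tail a (k * (a * a) + b) p′)
  tail-+ka² zero t = _ , ≤-refl , t
  tail-+ka² {i} {b} (suc k) t =
    let a = 2 + i
        p′ , le , t′ = tail-+ka² k t
        p″ , lt , t″ = tail-+a² t′
    in  p″ , ≤-trans (s≤s le) lt ,
        subst (λ c → Tail a c p″) (trans (+-comm _ (a * a)) (sym (+-assoc (a * a) (k * (a * a)) b))) t″

  -- Two such values differ by `k` shifts by `a²`, each of which lengthens the path, so equal
  -- lengths force `k = 0`. Hence `a` admits at most `a²` values of `b`.
  tail-unique-mod : ∀ {i b b′ p} (let a = 2 + i) → Tail a b p → Tail a b′ p →
                    b % (a * a) ≡ b′ % (a * a) → b ≡ b′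
  tail-unique-mod {i} {b} {b′} {p} t t′ e =
    [ ordered t t′ e , (λ le → sym (ordered t′ t (sym e) le)) ]′ (≤-total (b / N) (b′ / N))
    where
    N = (2 + i) * (2 + i)
    ordered : ∀ {b b′} → Tail (2 + i) b p → Tail (2 + i) b′ p →
              b % N ≡ b′ % N → b / N ≤ b′ / N → b ≡ b′
    ordered {b} {b′} t t′ e le = trans (cong (λ k → k * N + b) (sym k≡0)) shifted
      where
      k = b′ / N ∸ b / N
      shifted : k * N + b ≡ b′
      shifted = begin
        k * N + b                      ≡⟨ cong (k * N +_) (m≡m%n+[m/n]*n b N) ⟩
        k * N + (b % N + (b / N) * N)  ≡⟨ arith k (b / N) (b % N) N ⟩
        b % N + (k + b / N) * N        ≡⟨ cong₂ (λ x y → x + y * N) e (m∸n+n≡m le) ⟩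
        b′ % N + (b′ / N) * N          ≡⟨ m≡m%n+[m/n]*n b′ N ⟨
        b′                             ∎
        where
        open ≡-Reasoning
        arith : ∀ k q r N → k * N + (r + q * N) ≡ r + (k + q) * N
        arith = solve-∀
      k≡0 : k ≡ 0
      k≡0 = let p′ , k+p≤p′ , t″ = tail-+ka² k t
                p≡p′ = tail-det t′ (subst (λ c → Tail (2 + i) c p′) shifted t″)
            in n≤0⇒n≡0 (+-cancelʳ-≤ p k 0 (≤-trans k+p≤p′ (≤-reflexive (sym p≡p′))))

  -- The distance from a + b to the nearest multiple of a², where a = 2 + i.
  fold : ℕ → ℕ → ℕ
  fold i b = r ⊓ ((2 + i) * (2 + i) ∸ r)
    where r = (2 + i + b) % ((2 + i) * (2 + i))

  -- For `a + b = (k + 1) a² + s` the run is explicit: `i` left steps, a right step to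
  -- `(k a² + s, a²)`, `k` left steps, a right step to `(s, a² - s)`, then the given run.
  steps⇒tail : ∀ {i p s A B} (let a = 2 + i) → s < a * a → Steps s (a * a ∸ s) A B → 2 + A ≤ a → 2 * a ≤ 4 + p →
    ∃[ b ] (a < b × Tail a b p × (a + b) % (a * a) ≡ s)
  steps⇒tail {i} {p} {s} {A} {B} s<N st A<a 2a≤n =
    b , a<b ,
    tail total (castʳ (sym a+b≡t) (subst (λ q → Steps (i * t + (k * N + s)) t q (2 + B)) count
      (lefts i (right (lefts k (castʳ (m+[n∸m]≡n (<⇒≤ s<N)) (right st))))))) ,
    (begin-equality
      (a + b) % N          ≡⟨ cong (_% N) (trans a+b≡t (mod-arith k N s)) ⟩
      (s + suc k * N) % N  ≡⟨ [m+kn]%n≡m%n s (suc k) N ⟩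
      s % N                ≡⟨ m<n⇒m%n≡m s<N ⟩
      s                    ∎)
    where
    open ≤-Reasoning
    a = 2 + i
    N = a * a
    -- The solution of `i + k + A = p`. The subtraction is exact: `2 + A ≤ a` and `2a ≤ 4 + p` give
    -- `a + A ≤ 2 + p`.
    k = 2 + p ∸ (a + A)
    t = k * N + s + N
    b = t ∸ a
    mod-arith : ∀ k N s → k * N + s + N ≡ s + suc k * N
    mod-arith = solve-∀
    k+ : k + (a + A) ≡ 2 + p
    k+ = m∸n+n≡m (+-cancelˡ-≤ 2 _ _ (begin
      2 + (a + A)   ≡⟨ shuffle a A ⟩
      a + (2 + A)   ≤⟨ +-monoʳ-≤ a A<a ⟩
      a + a         ≡⟨ cong (a +_) (+-identityʳ a) ⟨
      2 * a         ≤⟨ 2a≤n ⟩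
      4 + p         ∎))
      where
      shuffle : ∀ a A → 2 + (a + A) ≡ a + (2 + A)
      shuffle = solve-∀
    count : i + (k + A) ≡ p
    count = +-cancelˡ-≡ 2 _ _ (trans (shuffle i k A) k+)
      where
      shuffle : ∀ i k A → 2 + (i + (k + A)) ≡ k + (2 + i + A)
      shuffle = solve-∀
    2a<t : 2 * a < t
    2a<t = begin-strict
      2 * a  ≤⟨ *-monoˡ-≤ a (m≤m+n 2 i) ⟩
      N      <⟨ m<n+m N (<-≤-trans (positiveˡ st) (m≤n+m s (k * N))) ⟩
      t      ∎
    a+b≡t : a + b ≡ t
    a+b≡t = m+[n∸m]≡n (≤-trans (m≤m+n a (a + 0)) (<⇒≤ 2a<t))
    a<b : a < b
    a<b = +-cancelˡ-< a a b (begin-strict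
      a + a   ≡⟨ cong (a +_) (+-identityʳ a) ⟨
      2 * a   <⟨ 2a<t ⟩
      t       ≡⟨ a+b≡t ⟨
      a + b   ∎)
    total : i * t + (k * N + s) + (a + b) ≡ a * b
    -- Adding `a²` turns both sides into `a (a + b)`.
    total = +-cancelʳ-≡ N _ _ (begin-equality
      i * t + (k * N + s) + (a + b) + N   ≡⟨ cong (λ x → i * t + (k * N + s) + x + N) a+b≡t ⟩
      i * t + (k * N + s) + t + N         ≡⟨ arith i t (k * N + s) N ⟩
      i * t + t + t                       ≡⟨ arith′ i t ⟩
      a * t                               ≡⟨ cong (a *_) a+b≡t ⟨
      a * (a + b)                         ≡⟨ *-distribˡ-+ a a b ⟩
      N + a * b                           ≡⟨ +-comm N (a * b) ⟩
      a * b + N                           ∎)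
      where
      arith : ∀ i t y N → i * t + y + t + N ≡ i * t + t + (y + N)
      arith = solve-∀
      arith′ : ∀ i t → i * t + t + t ≡ (2 + i) * t
      arith′ = solve-∀

  -- By `steps-product` the run from `(t, a² - t)` cannot have both counts at least `a - 1`.
  -- Whichever count is small decides between the residues `t` and `a² - t`, and `fold` sends both
  -- to `t`.
  tail-exists : ∀ {i j p} (let a = 2 + i) → 2 * suc j < a * a → 2 * a ≤ 4 + p →
    ∃[ b ] (a < b × Tail a b p × fold i b ≡ suc j)
  tail-exists {i} {j} {p} 2t<N 2a≤n =
    let A , B , st = steps-total t (N ∸ t) z<s (m<n⇒0<n∸m t<N) in pick st
    where
    a = 2 + i
    N = a * a
    t = suc j
    t+t<N : t + t < N
    t+t<N = subst (_< N) (cong (t +_) (+-identityʳ t)) 2t<N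
    t<N : t < N
    t<N = ≤-<-trans (m≤m+n t t) t+t<N
    t≤N∸t : t ≤ N ∸ t
    t≤N∸t = m+n≤o⇒m≤o∸n t (<⇒≤ t+t<N)
    fold≡ : ∀ {b s} → (a + b) % N ≡ s → s ⊓ (N ∸ s) ≡ t → fold i b ≡ t
    fold≡ refl eq = eq
    pick : ∀ {A B} → Steps t (N ∸ t) A B → ∃[ b ] (a < b × Tail a b p × fold i b ≡ t)
    pick {A} {B} st with 2 + A ≤? a
    ... | yes small =
      let b , a<b , tl , e = steps⇒tail t<N st small 2a≤n
      in  b , a<b , tl , fold≡ {b} e (m≤n⇒m⊓n≡m t≤N∸t)
    -- Now `B` is small, and it is the left count of the swapped run, which starts at `a² - t`.
    ... | no large =
      let b , a<b , tl , e = steps⇒tail (∸-monoʳ-< {N} {t} {0} z<s (<⇒≤ t<N))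
                               (castʳ (sym (m∸[m∸n]≡n (<⇒≤ t<N))) (swapSteps st)) B-small 2a≤n
      in  b , a<b , tl , fold≡ {b} e (trans (cong ((N ∸ t) ⊓_) (m∸[m∸n]≡n (<⇒≤ t<N))) (m≥n⇒m⊓n≡n t≤N∸t))
      where
      product : suc A * suc B < N
      product = subst (suc A * suc B <_) (m+[n∸m]≡n (<⇒≤ t<N)) (steps-product st)
      B-small : 2 + B ≤ a
      B-small = ≰⇒> λ a≤1+B → <-irrefl refl (<-≤-trans product (*-mono-≤ (≤-pred (≰⇒> large)) a≤1+B))

  -- Smooth structures

  -- Chain w ds rs: along a path hanging from a vertex with r-value w, the vertices carry the d- and
  -- r-values ds and rs, nearest first.
  data Chain : ∀ {m} → ℕ → Vec ℕ (suc m) → Vec ℕ (suc m) → Set where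
    end  : ∀ {w d r} → 2 ≤ d → 0 < r → d * r ≡ w → Chain w (d ∷ []) (r ∷ [])
    link : ∀ {m w d r r′} {ds : Vec ℕ (suc m)} {rs} → 2 ≤ d → 0 < r → d * r ≡ w + r′ →
           Chain r ds (r′ ∷ rs) → Chain w (d ∷ ds) (r ∷ r′ ∷ rs)

  -- Induction from the free end: `2r ≤ d r = w + r′ < w + r`.
  chain-decreasing : ∀ {m w r} {ds : Vec ℕ (suc m)} {rs} → Chain w ds (r ∷ rs) → r < w
  chain-decreasing {r = r} (end {d = d} 2≤d 0<r e) = begin-strict
    r        <⟨ m<m+n r 0<r ⟩
    r + r    ≡⟨ cong (r +_) (+-identityʳ r) ⟨
    2 * r    ≤⟨ *-monoˡ-≤ r 2≤d ⟩
    d * r    ≡⟨ e ⟩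
    _        ∎
    where open ≤-Reasoning
  chain-decreasing {w = w} {r = r} (link {d = d} {r′ = r′} 2≤d _ e c) = +-cancelʳ-< r r w (begin-strict
    r + r    ≡⟨ cong (r +_) (+-identityʳ r) ⟨
    2 * r    ≤⟨ *-monoˡ-≤ r 2≤d ⟩
    d * r    ≡⟨ e ⟩
    w + r′   <⟨ +-monoʳ-< w (chain-decreasing c) ⟩
    w + r    ∎)
    where open ≤-Reasoning

  chain-∣ : ∀ {m w r k} {ds : Vec ℕ (suc m)} {rs} → Chain w ds (r ∷ rs) → k ∣ w → k ∣ r →
            ∀ i → k ∣ Vec.lookup (r ∷ rs) i
  chain-∣ _ _ k∣r zero = k∣r
  chain-∣ {k = k} (link {d = d} _ _ e c) k∣w k∣r (suc i) =
    chain-∣ c k∣r (∣m+n∣m⇒∣n (subst (k ∣_) e (∣n⇒∣m*n d k∣r)) k∣w) i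

  -- A remainder `s < r` makes `d` the ceiling of `w / r`; used in both directions, this shows that
  -- `w` and `r` determine `d`.
  ceiling-≤ : ∀ {d d′ r w s s′} → s < r → s′ < r → d * r ≡ w + s → d′ * r ≡ w + s′ → d ≤ d′
  ceiling-≤ {d} {d′} {r} {w} {s} {s′} s<r s′<r e e′ = ≮⇒≥ λ d′<d → <-irrefl refl (begin-strict
    d * r         ≡⟨ e ⟩
    w + s         <⟨ +-mono-≤-< (m≤m+n w s′) s<r ⟩
    w + s′ + r    ≡⟨ cong (_+ r) e′ ⟨
    d′ * r + r    ≡⟨ +-comm (d′ * r) r ⟩
    suc d′ * r    ≤⟨ *-monoˡ-≤ r d′<d ⟩
    d * r         ∎)
    where open ≤-Reasoning

  chain-unique : ∀ {m w r} {ds ds′ : Vec ℕ (suc m)} {rs rs′} →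
                 Chain w ds (r ∷ rs) → Chain w ds′ (r ∷ rs′) → ds ≡ ds′ × rs ≡ rs′
  chain-unique (end {d = d} {r} _ 0<r e) (end {d = d′} _ _ e′) =
    cong (_∷ []) (*-cancelʳ-≡ d d′ r {{>-nonZero 0<r}} (trans e (sym e′))) , refl
  chain-unique (link {w = w} {d} {r} {r′} _ _ e c) (link {d = d′} {r′ = r″} _ _ e′ c′)
    with refl ← ≤-antisym (ceiling-≤ {d} {d′} (chain-decreasing c) (chain-decreasing c′) e e′)
                          (ceiling-≤ {d′} {d} (chain-decreasing c′) (chain-decreasing c) e′ e)
    with refl ← +-cancelˡ-≡ w r′ r″ (trans (sym e) e′)
    with refl , refl ← chain-unique c c′ = refl , refl

  -- In terms of `(r, w - r)`, a vertex of weight `d` accounts for `d - 2` right steps, and each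
  -- passage to the next vertex for one left step.
  chain⇒steps : ∀ {m w r s} {ds : Vec ℕ (suc m)} {rs} → Chain w ds (r ∷ rs) → r + s ≡ w →
                ∃[ B ] Steps r s m B
  chain⇒steps {r = r} {s} (end {d = suc (suc e)} _ 0<r eq) eq′ =
    e + 0 , castʳ (+-cancelˡ-≡ r _ _ (trans (cong (r +_) (+-comm (e * r) r)) (trans eq (sym eq′)))) (rights e (done 0<r))
  chain⇒steps (end {d = 1} (s≤s ()) _ _) _
  chain⇒steps {w = w} {r} {s} (link {d = suc (suc e)} {r′ = r′} _ _ eq c) eq′ =
    let B , st = chain⇒steps c r′+s′≡r
    in  e + B , castʳ s-split (rights e (castˡ r′+s′≡r (left st)))
    where
    s′ = r ∸ r′
    r′+s′≡r : r′ + s′ ≡ r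
    r′+s′≡r = m+[n∸m]≡n (<⇒≤ (chain-decreasing c))
    s-split : e * r + s′ ≡ s
    s-split = +-cancelʳ-≡ (r + r′) _ _ (begin
      e * r + s′ + (r + r′)   ≡⟨ arith (e * r) s′ r r′ ⟩
      r + (r′ + s′ + e * r)   ≡⟨ cong (λ x → r + (x + e * r)) r′+s′≡r ⟩
      r + (r + e * r)         ≡⟨ eq ⟩
      w + r′                  ≡⟨ cong (_+ r′) eq′ ⟨
      r + s + r′              ≡⟨ arith′ r s r′ ⟩
      s + (r + r′)            ∎)
      where
      open ≡-Reasoning
      arith : ∀ x s r r′ → x + s + (r + r′) ≡ r + (r′ + s + x)
      arith = solve-∀
      arith′ : ∀ r s r′ → r + s + r′ ≡ s + (r + r′)
      arith′ = solve-∀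
  chain⇒steps (link {d = 1} (s≤s ()) _ _ _) _

  chain-suc : ∀ {m w d r} {ds : Vec ℕ m} {rs} → Chain w (d ∷ ds) (r ∷ rs) → Chain (r + w) (suc d ∷ ds) (r ∷ rs)
  chain-suc {r = r} (end 2≤d 0<r e) = end (m≤n⇒m≤1+n 2≤d) 0<r (cong (r +_) e)
  chain-suc {w = w} {r = r} (link {r′ = r′} 2≤d 0<r e c) =
    link (m≤n⇒m≤1+n 2≤d) 0<r (trans (cong (r +_) e) (sym (+-assoc r w r′))) c

  -- The inverse translation: `done` is a single vertex of weight 2, `left` puts a new vertex of
  -- weight 2 in front, and `right` raises the first weight by one.
  steps⇒chain : ∀ {x y A B} → Steps x y A B → ∃[ ds ] ∃[ rs ] Chain {A} (x + y) ds (x ∷ rs)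
  steps⇒chain (done {g} 0<g) = _ , _ , end ≤-refl 0<g (cong (g +_) (+-identityʳ g))
  steps⇒chain (left {x} {y} s) =
    let ds , rs , c = steps⇒chain s
    in  _ , _ , link ≤-refl (≤-<-trans z≤n (chain-decreasing c)) (arith x y) c
    where
    arith : ∀ x y → 2 * (x + y) ≡ x + y + y + x
    arith = solve-∀
  steps⇒chain (right s) with steps⇒chain s
  ... | _ ∷ _ , rs , c = _ , rs , chain-suc c

  -- a, b are d_x, d_y and x, y, w, z are r_x, r_y, r₀, r₁.
  data Bident {p : ℕ} : Vec ℕ (4 + p) × Vec ℕ (4 + p) → Set where
    bident : ∀ {a b x y w z ds zs} → 2 ≤ a → 2 ≤ b → 0 < x → 0 < y → Coprime x y →
             a * x ≡ w → b * y ≡ w → z + (x + y) ≡ w → Chain w ds (z ∷ zs) →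
             Bident (a ∷ b ∷ 1 ∷ ds , x ∷ y ∷ w ∷ z ∷ zs)

  -- Passing between prong weights and primitive r-vectors

  coprime-proportion : ∀ {a b x y} → 0 < x → 0 < b → Coprime x y → a * x ≡ b * y →
                       ∃[ g ] (0 < g × a ≡ g * y × b ≡ g * x)
  coprime-proportion {a} {b} {x} {y} 0<x 0<b cop e
    with divides g refl ← coprime-divisor {o = b} cop (divides a (trans (*-comm y b) (sym e))) =
    g , pos g 0<b , *-cancelʳ-≡ a (g * y) x {{>-nonZero 0<x}} (trans e (arith g x y)) , refl
    where
    pos : ∀ g → 0 < g * x → 0 < g
    pos (suc _) _ = z<s
    arith : ∀ g x y → g * x * y ≡ g * y * x
    arith = solve-∀

  prongs : ∀ {p} → Vec ℕ (4 + p) × Vec ℕ (4 + p) → ℕ × ℕ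
  prongs (a ∷ b ∷ _ , _) = a , b

  -- With `a = g y` and `b = g x`, multiplying the r-values `x, y, w, z` by `g` gives
  -- `b, a, ab, ab - a - b`; scaling does not change the step counts.
  bident⇒tail : ∀ {p a b dr} → Bident {p} dr → prongs dr ≡ (a , b) → Tail a b p
  bident⇒tail (bident {a} {b} {x} {y} {w} {z} 2≤a 2≤b 0<x 0<y cop e f h c) refl
    with g , 0<g , refl , refl ← coprime-proportion {a} {b} 0<x (≤-trans (s≤s z≤n) 2≤b) cop (trans e (sym f)) =
    let B , st = chain⇒steps c h
    in  tail {X = g * z}
          (trans (arith g x y z) (trans (cong (g *_) (trans h (sym e))) (arith′ g y x)))
          (castʳ (arith″ g x y) (scaleSteps g 0<g st))
    where
    arith : ∀ g x y z → g * z + (g * y + g * x) ≡ g * (z + (x + y))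
    arith = solve-∀
    arith′ : ∀ g y x → g * (g * y * x) ≡ g * y * (g * x)
    arith′ = solve-∀
    arith″ : ∀ g x y → g * (x + y) ≡ g * y + g * x
    arith″ = solve-∀

  gcd-of-coprime-multiples : ∀ {a b g x y} → a ≡ g * y → b ≡ g * x → Coprime x y → gcd a b ≡ g
  gcd-of-coprime-multiples {g = g} {x} {y} refl refl cop = begin
    gcd (g * y) (g * x)  ≡⟨ c*gcd[m,n]≡gcd[cm,cn] g y x ⟨
    g * gcd y x          ≡⟨ cong (g *_) (trans (gcd-comm y x) (coprime⇒gcd≡1 cop)) ⟩
    g * 1                ≡⟨ *-identityʳ g ⟩
    g                    ∎
    where open ≡-Reasoning

  coprime-cofactors : ∀ {a b} → 0 < a → ∃[ g ] ∃[ x ] ∃[ y ] (0 < g × a ≡ g * y × b ≡ g * x × Coprime x y)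
  coprime-cofactors {a} {b} 0<a with gcd[m,n]∣m a b | gcd[m,n]∣n a b
  ... | divides y a≡yg | divides x b≡xg = g , x , y , 0<g , a≡gy , b≡gx , gcd≡1⇒coprime gcd≡1
    where
    g = gcd a b
    a≡gy = trans a≡yg (*-comm y g)
    b≡gx = trans b≡xg (*-comm x g)
    pos : ∀ g → 0 < g * y → 0 < g
    pos (suc _) _ = z<s
    0<g = pos g (subst (0 <_) a≡gy 0<a)
    gcd≡1 : gcd x y ≡ 1
    gcd≡1 = *-cancelˡ-≡ (gcd x y) 1 g {{>-nonZero 0<g}} (begin
      g * gcd x y          ≡⟨ c*gcd[m,n]≡gcd[cm,cn] g x y ⟩
      gcd (g * x) (g * y)  ≡⟨ cong₂ gcd b≡gx a≡gy ⟨
      gcd b a              ≡⟨ gcd-comm b a ⟩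
      g                    ≡⟨ *-identityʳ g ⟨
      g * 1                ∎)
      where open ≡-Reasoning

  -- The gcd `g` of `a` and `b` divides `ab` and `a + b`, hence also `X`, so the whole pair can be
  -- divided by `g` and its run turned back into a chain.
  tail⇒bident : ∀ {p a b} → 2 ≤ a → 2 ≤ b → Tail a b p →
                ∃[ dr ] (Bident {p} dr × prongs dr ≡ (a , b))
  tail⇒bident {p} {a} {b} 2≤a 2≤b (tail {X} e s)
    with g , x , y , 0<g , refl , refl , cop ← coprime-cofactors {a} {b} (<-≤-trans z<s 2≤a)
    with divides z refl ← ∣m+n∣m⇒∣n {g} {g * y + g * x} {X}
           (subst (g ∣_) (trans (sym e) (+-comm X _)) (∣n⇒∣m*n (g * y) (∣m⇒∣m*n x ∣-refl)))
           (∣m∣n⇒∣m+n (∣m⇒∣m*n y ∣-refl) (∣m⇒∣m*n x ∣-refl)) =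
    let _ , st = descaleSteps {z} {x + y} g 0<g (castˡ (*-comm z g) (castʳ (arith g x y) s))
        ds , zs , c = steps⇒chain st
    in  _ ,
        bident 2≤a 2≤b (factor g x 2≤b) (factor g y 2≤a) cop refl (arith‴ g x y) total
          (subst (λ w → Chain w ds (z ∷ zs)) total c) ,
        refl
    where
    factor : ∀ g x → 2 ≤ g * x → 0 < x
    factor g zero    le = contradiction (subst (2 ≤_) (*-zeroʳ g) le) λ ()
    factor g (suc x) _  = z<s
    arith : ∀ g x y → g * y + g * x ≡ g * (x + y)
    arith = solve-∀
    arith′ : ∀ g x y z → g * (z + (x + y)) ≡ z * g + (g * y + g * x)
    arith′ = solve-∀
    arith″ : ∀ g x y → g * y * (g * x) ≡ g * (g * y * x)
    arith″ = solve-∀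
    arith‴ : ∀ g x y → g * x * y ≡ g * y * x
    arith‴ = solve-∀
    total : z + (x + y) ≡ g * y * x
    total = *-cancelˡ-≡ _ _ g {{>-nonZero 0<g}} (trans (arith′ g x y z) (trans e (arith″ g x y)))

  -- The scale factor is `gcd a b` on both sides. This fixes `x` and `y`, then `w = a x` and
  -- `z = w - x - y`, and `chain-unique` fixes the rest of the path.
  bident-unique : ∀ {p dr dr′} → Bident {p} dr → Bident {p} dr′ → prongs dr ≡ prongs dr′ → dr ≡ dr′
  bident-unique (bident {a} {b} {x} {y} {w} {z} 2≤a 2≤b 0<x 0<y cop e f h c)
                (bident {x = x′} {y′} {w′} {z′} _ _ 0<x′ _ cop′ e′ f′ h′ c′) refl
    with 0<b ← <-≤-trans z<s 2≤b
    with g , 0<g , p , q ← coprime-proportion {a} {b} 0<x 0<b cop (trans e (sym f))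
    with g′ , 0<g′ , p′ , q′ ← coprime-proportion {a} {b} 0<x′ 0<b cop′ (trans e′ (sym f′))
    with refl ← trans (sym (gcd-of-coprime-multiples {a} {b} {g} {x} {y} p q cop))
                       (gcd-of-coprime-multiples {a} {b} {g′} {x′} {y′} p′ q′ cop′)
    with refl ← *-cancelˡ-≡ x x′ g {{>-nonZero 0<g}} (trans (sym q) q′)
    with refl ← *-cancelˡ-≡ y y′ g {{>-nonZero 0<g}} (trans (sym p) p′)
    with refl ← trans (sym e) e′
    with refl ← +-cancelʳ-≡ (x + y) z z′ (trans h (sym h′))
    with refl , refl ← chain-unique c c′ = refl

  -- Rows of the adjacency matrix and the two forms of smoothness

  pathRow : ∀ {m} → ℕ → Vec ℕ m → ℕ
  pathRow k v = sum (tabulate (λ j → bidentAdjℕ (2 + k) (2 + toℕ j) * Vec.lookup v j))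

  sum-tabulate-0 : ∀ m → sum (tabulate {n = m} (λ _ → 0)) ≡ 0
  sum-tabulate-0 zero    = refl
  sum-tabulate-0 (suc m) = sum-tabulate-0 m

  pathRow-0 : ∀ {m} u v (vs : Vec ℕ m) → pathRow 0 (u ∷ v ∷ vs) ≡ v
  pathRow-0 {m} u v vs = trans (cong₂ _+_ (*-identityˡ v) (sum-tabulate-0 m)) (+-identityʳ v)

  rows⇒chain : ∀ {m} w (ds rs : Vec ℕ (suc m)) → (∀ i → 2 ≤ Vec.lookup ds i) → (∀ i → 0 < Vec.lookup rs i) →
               (∀ i → Vec.lookup ds i * Vec.lookup rs i ≡ pathRow (suc (toℕ i)) (w ∷ rs)) → Chain w ds rs
  rows⇒chain w (d ∷ []) (r ∷ []) 2≤d 0<r row =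
    end (2≤d zero) (0<r zero) (trans (row zero) (trans (+-identityʳ _) (+-identityʳ w)))
  rows⇒chain w (d ∷ ds@(_ ∷ _)) (r ∷ r′ ∷ rs) 2≤d 0<r row =
    link (2≤d zero) (0<r zero) (trans (row zero) (cong₂ _+_ (*-identityˡ w) (pathRow-0 r r′ rs)))
      -- For later rows the column of `w` contributes `0 * w`, and lowering both indices by one
      -- preserves adjacency, so these rows agree by computation.
      (rows⇒chain r ds (r′ ∷ rs) (λ i → 2≤d (suc i)) (λ i → 0<r (suc i)) (λ i → row (suc i)))

  chain⇒row : ∀ {m w} {ds rs : Vec ℕ (suc m)} → Chain w ds rs →
              ∀ i → Vec.lookup ds i * Vec.lookup rs i ≡ pathRow (suc (toℕ i)) (w ∷ rs)
  chain⇒row {w = w} (end _ _ e) zero = trans e (sym (trans (+-identityʳ _) (+-identityʳ w)))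
  chain⇒row {w = w} (link {r = r} {r′} {rs = rs} _ _ e c) zero =
    trans e (sym (cong₂ _+_ (*-identityˡ w) (pathRow-0 r r′ rs)))
  chain⇒row (link _ _ _ c) (suc i) = chain⇒row c i

  chain⇒2≤d : ∀ {m w} {ds rs : Vec ℕ (suc m)} → Chain w ds rs → ∀ i → 2 ≤ Vec.lookup ds i
  chain⇒2≤d (end 2≤d _ _)    zero    = 2≤d
  chain⇒2≤d (link 2≤d _ _ _) zero    = 2≤d
  chain⇒2≤d (link _ _ _ c)   (suc i) = chain⇒2≤d c i

  chain⇒0<r : ∀ {m w} {ds rs : Vec ℕ (suc m)} → Chain w ds rs → ∀ i → 0 < Vec.lookup rs i
  chain⇒0<r (end _ 0<r _)    zero    = 0<r
  chain⇒0<r (link _ 0<r _ _) zero    = 0<r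
  chain⇒0<r (link _ _ _ c)   (suc i) = chain⇒0<r c i

  prongRow : ∀ m w → 1 * w + sum (tabulate {n = m} (λ _ → 0)) ≡ w
  prongRow m w = trans (cong₂ _+_ (*-identityˡ w) (sum-tabulate-0 m)) (+-identityʳ w)

  centreRow : ∀ {m} x y w z (zs : Vec ℕ m) → 1 * x + (1 * y + pathRow 0 (w ∷ z ∷ zs)) ≡ z + (x + y)
  centreRow x y w z zs =
    trans (cong₂ _+_ (*-identityˡ x) (cong₂ _+_ (*-identityˡ y) (pathRow-0 w z zs))) (arith x y z)
    where
    arith : ∀ x y z → x + (y + z) ≡ z + (x + y)
    arith = solve-∀

  -- d₀ r₀ = r_x + r_y + r₁ < r₀/2 + r₀/2 + r₀ forces d₀ = 1.
  centre≡1 : ∀ {a b d₀ x y w z} → 2 ≤ a → 2 ≤ b → 0 < d₀ → a * x ≡ w → b * y ≡ w → z < w →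
             d₀ * w ≡ z + (x + y) → d₀ ≡ 1
  centre≡1 {a} {b} {d₀} {x} {y} {w} {z} 2≤a 2≤b 0<d₀ e f z<w row =
    ≤-antisym (≮⇒≥ λ 1<d₀ → <-irrefl refl (begin-strict
      2 * (2 * w)              ≤⟨ *-monoʳ-≤ 2 (*-monoˡ-≤ w 1<d₀) ⟩
      2 * (d₀ * w)             ≡⟨ cong (2 *_) row ⟩
      2 * (z + (x + y))        ≡⟨ arith x y z ⟩
      2 * z + (2 * x + 2 * y)  ≤⟨ +-monoʳ-≤ (2 * z) (+-mono-≤ (*-monoˡ-≤ x 2≤a) (*-monoˡ-≤ y 2≤b)) ⟩
      2 * z + (a * x + b * y)  ≡⟨ cong₂ (λ u v → 2 * z + (u + v)) e f ⟩
      2 * z + (w + w)          <⟨ +-monoˡ-< (w + w) (*-monoʳ-< 2 z<w) ⟩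
      2 * w + (w + w)          ≡⟨ arith′ w ⟩
      2 * (2 * w)              ∎)) 0<d₀
    where
    open ≤-Reasoning
    arith : ∀ x y z → 2 * (z + (x + y)) ≡ 2 * z + (2 * x + 2 * y)
    arith = solve-∀
    arith′ : ∀ w → 2 * w + (w + w) ≡ 2 * (2 * w)
    arith′ = solve-∀

  -- Besides `d₀ = 1`, coprimality of `x` and `y` has to be derived: a common divisor divides
  -- `w = a x`, then `z = w - x - y`, then every entry along the path, so primitivity makes it 1.
  smooth⇒bident : ∀ {p} dr → IsSmoothArith (4 + p) dr → Bident {p} dr
  smooth⇒bident {p} (a ∷ b ∷ d₀ ∷ ds , x ∷ y ∷ w ∷ z ∷ zs) ((0<d , 0<r , row , prim) , 2≤d) =
    conclude (centre≡1 {a} {b} {d₀} {x} {y} 2≤a 2≤b (0<d (suc (suc zero))) e f (chain-decreasing c) row₀)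
    where
    2≤a = 2≤d zero λ ()
    2≤b = 2≤d (suc zero) λ ()
    e = trans (row zero) (prongRow (suc p) w)
    f = trans (row (suc zero)) (prongRow (suc p) w)
    row₀ = trans (row (suc (suc zero))) (centreRow x y w z zs)
    c = rows⇒chain w ds (z ∷ zs) (λ i → 2≤d (suc (suc (suc i))) λ ())
          (λ i → 0<r (suc (suc (suc i)))) (λ i → row (suc (suc (suc i))))
    conclude : d₀ ≡ 1 → Bident (a ∷ b ∷ d₀ ∷ ds , x ∷ y ∷ w ∷ z ∷ zs)
    conclude refl = bident 2≤a 2≤b (0<r zero) (0<r (suc zero)) cop e f h c
      where
      h : z + (x + y) ≡ w
      h = trans (sym row₀) (*-identityˡ w)
      cop : Coprime x y
      cop {k} (k∣x , k∣y) = prim k all∣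
        where
        k∣w : k ∣ w
        k∣w = subst (k ∣_) e (∣n⇒∣m*n a k∣x)
        k∣z : k ∣ z
        k∣z = ∣m+n∣m⇒∣n (subst (k ∣_) (trans (sym h) (+-comm z (x + y))) k∣w) (∣m∣n⇒∣m+n k∣x k∣y)
        all∣ : ∀ i → k ∣ Vec.lookup (x ∷ y ∷ w ∷ z ∷ zs) i
        all∣ zero                = k∣x
        all∣ (suc zero)          = k∣y
        all∣ (suc (suc zero))    = k∣w
        all∣ (suc (suc (suc i))) = chain-∣ c k∣w k∣z i

  bident⇒smooth : ∀ {p dr} → Bident {p} dr → IsSmoothArith (4 + p) dr
  bident⇒smooth {p} (bident {a} {b} {x} {y} {w} {z} {ds} {zs} 2≤a 2≤b 0<x 0<y cop e f h c) =
    (0<d , 0<r , row , prim) , 2≤d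
    where
    0<w : 0 < w
    0<w = ≤-<-trans z≤n (chain-decreasing c)
    2≤d : ∀ i → toℕ i ≢ 2 → 2 ≤ Vec.lookup (a ∷ b ∷ 1 ∷ ds) i
    2≤d zero                i≢2 = 2≤a
    2≤d (suc zero)          i≢2 = 2≤b
    2≤d (suc (suc zero))    i≢2 = contradiction refl i≢2
    2≤d (suc (suc (suc i))) i≢2 = chain⇒2≤d c i
    0<d : ∀ i → 0 < Vec.lookup (a ∷ b ∷ 1 ∷ ds) i
    0<d zero                = <-≤-trans z<s 2≤a
    0<d (suc zero)          = <-≤-trans z<s 2≤b
    0<d (suc (suc zero))    = z<s
    0<d (suc (suc (suc i))) = <-≤-trans z<s (chain⇒2≤d c i)
    0<r : ∀ i → 0 < Vec.lookup (x ∷ y ∷ w ∷ z ∷ zs) i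
    0<r zero                = 0<x
    0<r (suc zero)          = 0<y
    0<r (suc (suc zero))    = 0<w
    0<r (suc (suc (suc i))) = chain⇒0<r c i
    row : ∀ i → Vec.lookup (a ∷ b ∷ 1 ∷ ds) i * Vec.lookup (x ∷ y ∷ w ∷ z ∷ zs) i ≡
          sum (tabulate (λ j → bidentAdj (4 + p) i j * Vec.lookup (x ∷ y ∷ w ∷ z ∷ zs) j))
    row zero                = trans e (sym (prongRow (suc p) w))
    row (suc zero)          = trans f (sym (prongRow (suc p) w))
    row (suc (suc zero))    = trans (*-identityˡ w) (trans (sym h) (sym (centreRow x y w z zs)))
    row (suc (suc (suc i))) = chain⇒row c i
    prim : ∀ k → (∀ i → k ∣ Vec.lookup (x ∷ y ∷ w ∷ z ∷ zs) i) → k ≡ 1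
    prim k k∣r = cop (k∣r zero , k∣r (suc zero))

  -- Counting along codes

  lookup-injective : {xs : List A} → Unique xs → ∀ {i j} → lookup xs i ≡ lookup xs j → i ≡ j
  lookup-injective (_ ∷ _)   {zero}  {zero}  _  = refl
  lookup-injective (x∉ ∷ _)  {zero}  {suc j} eq = contradiction eq (All.lookup x∉ (∈-lookup j))
  lookup-injective (x∉ ∷ _)  {suc i} {zero}  eq = contradiction (sym eq) (All.lookup x∉ (∈-lookup i))
  lookup-injective (_ ∷ xs!) {suc i} {suc j} eq = cong suc (lookup-injective xs! eq)

  -- Pigeonhole: sending a position in `xs` to the position of a code of its entry is an injection
  -- between finite index sets.
  length-≤-codes : (R : A → C → Set) → (∀ {x x′ c} → R x c → R x′ c → x ≡ x′) →
                   ∀ {xs cs} → Unique xs → All (λ x → Any (R x) cs) xs → length xs ≤ length cs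
  length-≤-codes R inj {xs} {cs} xs! coded = injective⇒≤ {f = code} λ {i} {j} eq →
    lookup-injective xs! (inj (codes i) (subst (λ k → R (lookup xs j) (lookup cs k)) (sym eq) (codes j)))
    where
    any : ∀ i → Any (R (lookup xs i)) cs
    any i = All.lookup coded (∈-lookup i)
    code : Fin (length xs) → Fin (length cs)
    code i = Any.index (any i)
    codes : ∀ i → R (lookup xs i) (lookup cs (code i))
    codes i = lookup-index (any i)

  -- The converse count: an object has only one code, so objects chosen for distinct codes are
  -- distinct.
  decode-list : (R : A → C → Set) → (∀ {x c c′} → R x c → R x c′ → c ≡ c′) →
                ∀ {cs} → Unique cs → All (λ c → ∃[ x ] R x c) cs →
                ∃[ xs ] (Unique xs × All (λ x → ∃[ c ] R x c) xs × length xs ≡ length cs)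
  decode-list R det cs! decodes =
    let xs , xs~cs = pointwise decodes
    in  xs , unique cs! xs~cs , all xs~cs , Pointwise-length xs~cs
    where
    pointwise : ∀ {cs} → All (λ c → ∃[ x ] R x c) cs → ∃[ xs ] Pointwise R xs cs
    pointwise []             = [] , []
    pointwise ((x , r) ∷ rs) = let xs , rs′ = pointwise rs in x ∷ xs , r ∷ rs′
    all : ∀ {xs cs} → Pointwise R xs cs → All (λ x → ∃[ c ] R x c) xs
    all []       = []
    all (r ∷ rs) = (_ , r) ∷ all rs
    fresh : ∀ {x c xs cs} → R x c → Pointwise R xs cs → All (c ≢_) cs → All (x ≢_) xs
    fresh r []       []         = []
    fresh r (s ∷ rs) (c≢ ∷ c∉) = (λ { refl → c≢ (det r s) }) ∷ fresh r rs c∉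
    unique : ∀ {xs cs} → Unique cs → Pointwise R xs cs → Unique xs
    unique []          []       = []
    unique (c∉ ∷ cs!) (r ∷ rs) = fresh r rs c∉ ∷ unique cs! rs

  -- Lattice points under a graph, orientations and finite sums

  sumTo : (ℕ → ℕ) → ℕ → ℕ
  sumTo f zero    = 0
  sumTo f (suc N) = f N + sumTo f N

  grid : (ℕ → ℕ) → ℕ → List (ℕ × ℕ)
  grid f zero    = []
  grid f (suc N) = map (N ,_) (upTo (f N)) ++ grid f N

  length-grid : ∀ f N → length (grid f N) ≡ sumTo f N
  length-grid f zero    = refl
  length-grid f (suc N) = trans (length-++ (map (N ,_) (upTo (f N))))
    (cong₂ _+_ (trans (length-map (N ,_) (upTo (f N))) (length-upTo (f N))) (length-grid f N))

  ∈-grid⁺ : ∀ {f N i j} → i < N → j < f i → (i , j) ∈ grid f N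
  ∈-grid⁺ {f} {suc N} {i} i<1+N j<fi with m<1+n⇒m<n∨m≡n i<1+N
  ... | inj₁ i<N  = ∈-++⁺ʳ (map (N ,_) (upTo (f N))) (∈-grid⁺ i<N j<fi)
  ... | inj₂ refl = ∈-++⁺ˡ (∈-map⁺ (N ,_) (∈-upTo⁺ j<fi))

  ∈-grid⁻ : ∀ {f} N {i j} → (i , j) ∈ grid f N → i < N × j < f i
  ∈-grid⁻ {f} (suc N) ∈g with ∈-++⁻ (map (N ,_) (upTo (f N))) ∈g
  ... | inj₁ ∈row with _ , j∈ , refl ← ∈-map⁻ (N ,_) ∈row = ≤-refl , ∈-upTo⁻ j∈
  ... | inj₂ ∈g′ = let i<N , j<fi = ∈-grid⁻ N ∈g′ in m≤n⇒m≤1+n i<N , j<fi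

  grid-unique : ∀ f N → Unique (grid f N)
  grid-unique f zero    = []
  grid-unique f (suc N) =
    Unique.++⁺ (Unique.map⁺ (λ { refl → refl }) (Unique.upTo⁺ (f N))) (grid-unique f N) disjoint
    where
    disjoint : ∀ {c} → c ∈ map (N ,_) (upTo (f N)) × c ∈ grid f N → _
    disjoint (∈row , ∈g) with _ , _ , refl ← ∈-map⁻ (N ,_) ∈row = <-irrefl refl (proj₁ (∈-grid⁻ N ∈g))

  orientations : List Bool
  orientations = false ∷ true ∷ []

  orientations-complete : ∀ o → o ∈ orientations
  orientations-complete false = here refl
  orientations-complete true  = there (here refl)

  length-oriented : (cs : List C) → length (cartesianProduct orientations cs) ≡ length cs + length cs
  length-oriented {C} cs = trans (length-++ (row false)) (cong₂ _+_ (length-map _ cs)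
    (trans (cong length (++-identityʳ (row true))) (length-map _ cs)))
    where
    row : Bool → List (Bool × C)
    row o = map (o ,_) cs

  orient : Bool → ℕ × ℕ → ℕ × ℕ
  orient false ab = ab
  orient true  ab = swap ab

  orient-injective : ∀ o {c c′} → orient o c ≡ orient o c′ → c ≡ c′
  orient-injective false eq = eq
  orient-injective true  eq = cong swap eq

  oriented-tail : ∀ {p a b dr} o → Bident {p} dr → orient o (prongs dr) ≡ (a , b) → Tail a b p
  oriented-tail false bd eq = bident⇒tail bd eq
  oriented-tail true  bd eq = tail-sym (bident⇒tail bd (cong swap eq))

  sumTo-shift : ∀ f N → sumTo f (suc N) ≡ f 0 + sumTo (λ i → f (suc i)) N
  sumTo-shift f zero    = refl
  sumTo-shift f (suc N) = trans (cong (f (suc N) +_) (sumTo-shift f N)) (arith (f (suc N)) (f 0) _)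
    where
    arith : ∀ x y z → x + (y + z) ≡ y + (x + z)
    arith = solve-∀

  -- A harmonic sum times `m`, rounded down term by term. The divisors start at 2, as do the terms
  -- of the Riemann sum for the logarithm.
  quotientSum : ℕ → ℕ → ℕ
  quotientSum m = sumTo (λ j → m / (2 + j))

  triangle : ℕ → ℕ
  triangle zero    = 0
  triangle (suc k) = suc k + triangle k

  2*triangle : ∀ k → 2 * triangle k ≡ k * suc k
  2*triangle zero    = refl
  2*triangle (suc k) =
    trans (*-distribˡ-+ 2 (suc k) (triangle k)) (trans (cong (2 * suc k +_) (2*triangle k)) (arith k))
    where
    arith : ∀ k → 2 * suc k + k * suc k ≡ suc k * suc (suc k)
    arith = solve-∀

  -- Upper count: residues for a small weight, a hyperbola for two large ones

  module Upper (p : ℕ) where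

    open ≤-Reasoning

    M : ℕ
    M = 2 + p

    -- The flag says whether (a, b) is (d_x, d_y) or (d_y, d_x).  A code inj₁ (i , j) stands for
    -- a = 2 + i ≤ M and b ≡ j mod a², a code inj₂ (i , j) for a = M + 1 + i and b = a + j.
    Code : Set
    Code = Bool × (ℕ × ℕ ⊎ ℕ × ℕ)

    Coded : Vec ℕ (4 + p) × Vec ℕ (4 + p) → Code → Set
    Coded dr (o , inj₁ (i , j)) =
      Bident dr × ∃[ b ] (orient o (prongs dr) ≡ (2 + i , b) × b % ((2 + i) * (2 + i)) ≡ j)
    Coded dr (o , inj₂ (i , j)) =
      Bident dr × orient o (prongs dr) ≡ (M + suc i , M + suc i + j)

    -- A low code keeps only a residue of `b`, which suffices by `tail-unique-mod` because the path
    -- length is fixed.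
    coded-injective : ∀ {dr dr′ c} → Coded dr c → Coded dr′ c → dr ≡ dr′
    coded-injective {c = o , inj₁ (i , j)} (bd , b , e , f) (bd′ , b′ , e′ , f′) =
      bident-unique bd bd′ (orient-injective o (trans e (trans (cong (2 + i ,_) b≡b′) (sym e′))))
      where
      b≡b′ : b ≡ b′
      b≡b′ = tail-unique-mod (oriented-tail o bd e) (oriented-tail o bd′ e′) (trans f (sym f′))
    coded-injective {c = o , inj₂ _} (bd , e) (bd′ , e′) =
      bident-unique bd bd′ (orient-injective o (trans e (sym e′)))

    -- `lowCount` counts the residues mod `a²`; `highCount i` counts the `j` with
    -- `(i + 1)(i + 1 + j) ≤ M²`.
    lowCount highCount : ℕ → ℕ
    lowCount i = (2 + i) * (2 + i)
    highCount i = M * M / suc i ∸ i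

    shapes : List (ℕ × ℕ ⊎ ℕ × ℕ)
    shapes = map inj₁ (grid lowCount (suc p)) ++ map inj₂ (grid highCount M)

    codes : List Code
    codes = cartesianProduct orientations shapes

    codesTotal : ℕ
    codesTotal = sumTo lowCount (suc p) + sumTo highCount M

    length-codes : length codes ≡ codesTotal + codesTotal
    length-codes = trans (length-oriented shapes) (cong₂ _+_ eq eq)
      where
      eq : length shapes ≡ codesTotal
      eq = trans (length-++ (map inj₁ (grid lowCount (suc p)))) (cong₂ _+_
        (trans (length-map inj₁ (grid lowCount (suc p))) (length-grid lowCount (suc p)))
        (trans (length-map inj₂ (grid highCount M)) (length-grid highCount M)))

    low-coded : ∀ {dr a b} o → Bident dr → orient o (prongs dr) ≡ (a , b) → 2 ≤ a → a ≤ M →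
                Any (Coded dr) codes
    low-coded {b = b} o bd e (s≤s (s≤s {n = i} _)) (s≤s a≤1+p) = lose
      (∈-cartesianProduct⁺ (orientations-complete o)
        (∈-++⁺ˡ (∈-map⁺ inj₁ (∈-grid⁺ {lowCount} a≤1+p (m%n<n b ((2 + i) * (2 + i)))))))
      (bd , b , e , refl)

    -- ab ≤ M(a + b) says that (a - M)(b - M) ≤ M².
    high-coded : ∀ {dr i j} o → Bident dr → orient o (prongs dr) ≡ (M + suc i , M + suc i + j) →
                 Any (Coded dr) codes
    high-coded {dr} {i} {j} o bd e = lose
      (∈-cartesianProduct⁺ (orientations-complete o)
        (∈-++⁺ʳ (map inj₁ (grid lowCount (suc p))) (∈-map⁺ inj₂ (∈-grid⁺ {highCount} i<M j<count))))
      (bd , e)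
      where
      hyperbola : suc i * (suc i + j) ≤ M * M
      hyperbola = +-cancelʳ-≤ (M * (M + suc i) + M * (suc i + j)) _ _ (begin
        suc i * (suc i + j) + (M * (M + suc i) + M * (suc i + j))  ≡⟨ arith M (suc i) j ⟩
        (M + suc i) * (M + suc i + j)                              ≤⟨ tail-≤ (oriented-tail o bd e) ⟩
        M * (M + suc i + (M + suc i + j))                          ≡⟨ arith′ M (suc i) j ⟩
        M * M + (M * (M + suc i) + M * (suc i + j))                ∎)
        where
        arith : ∀ M s j → s * (s + j) + (M * (M + s) + M * (s + j)) ≡ (M + s) * (M + s + j)
        arith = solve-∀
        arith′ : ∀ M s j → M * (M + s + (M + s + j)) ≡ M * M + (M * (M + s) + M * (s + j))
        arith′ = solve-∀
      i<M : i < M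
      i<M = ≮⇒≥ λ M<1+i → <-irrefl refl (begin-strict
        M * M                <⟨ *-mono-< M<1+i M<1+i ⟩
        suc i * suc i        ≤⟨ *-monoʳ-≤ (suc i) (m≤m+n (suc i) j) ⟩
        suc i * (suc i + j)  ≤⟨ hyperbola ⟩
        M * M                ∎)
      j<count : j < highCount i
      j<count = m+n≤o⇒m≤o∸n (suc j) (begin
        suc j + i                      ≡⟨ +-comm (suc j) i ⟩
        i + suc j                      ≡⟨ +-suc i j ⟩
        suc i + j                      ≡⟨ m*n/n≡m (suc i + j) (suc i) ⟨
        (suc i + j) * suc i / suc i    ≡⟨ cong (_/ suc i) (*-comm (suc i + j) (suc i)) ⟩
        suc i * (suc i + j) / suc i    ≤⟨ /-monoˡ-≤ (suc i) hyperbola ⟩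
        M * M / suc i                  ∎)

    shape : ∀ a b → M < a → a ≤ b → (a , b) ≡ (M + suc (a ∸ suc M) , M + suc (a ∸ suc M) + (b ∸ a))
    shape a b M<a a≤b = cong₂ _,_ a≡ (trans (sym (m+[n∸m]≡n a≤b)) (cong (_+ (b ∸ a)) a≡))
      where
      a≡ : a ≡ M + suc (a ∸ suc M)
      a≡ = trans (sym (m+[n∸m]≡n M<a)) (sym (+-suc M (a ∸ suc M)))

    all-coded : ∀ dr → Bident dr → Any (Coded dr) codes
    all-coded dr bd@(bident {a} {b} 2≤a 2≤b _ _ _ _ _ _ _) with a ≤? M | b ≤? M
    ... | yes a≤M | _       = low-coded false bd refl 2≤a a≤M
    ... | no  _   | yes b≤M = low-coded true bd refl 2≤b b≤M
    ... | no  a≰M | no b≰M with ≤-total a b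
    ...   | inj₁ a≤b = high-coded false bd (shape a b (≰⇒> a≰M) a≤b)
    ...   | inj₂ b≤a = high-coded true bd (shape b a (≰⇒> b≰M) b≤a)

    length-smooth-≤ : ∀ {xs} → Unique xs → All (IsSmoothArith (4 + p)) xs → length xs ≤ codesTotal + codesTotal
    length-smooth-≤ xs! smooth = ≤-trans
      (length-≤-codes Coded (λ {dr} {dr′} {c} → coded-injective {dr} {dr′} {c}) xs!
        (All.map (λ {dr} s → all-coded dr (smooth⇒bident dr s)) smooth))
      (≤-reflexive length-codes)

    quotients : ℕ
    quotients = quotientSum (M * M) p

    -- Since `(N + 1)(N + 2) ≤ M²` for `N < p`, the truncated subtractions are exact, and the
    -- subtracted numbers add up to a triangular number.
    highCount-triangle : ∀ N → N ≤ p → sumTo (λ i → highCount (suc i)) N + triangle N ≡ quotientSum (M * M) N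
    highCount-triangle zero    _   = refl
    highCount-triangle (suc N) N<p = begin-equality
      M * M / (2 + N) ∸ suc N + rest + (suc N + triangle N)    ≡⟨ arith (M * M / (2 + N) ∸ suc N) rest (suc N) (triangle N) ⟩
      M * M / (2 + N) ∸ suc N + suc N + (rest + triangle N)    ≡⟨ cong₂ _+_ (m∸n+n≡m fits) (highCount-triangle N (<⇒≤ N<p)) ⟩
      M * M / (2 + N) + quotientSum (M * M) N                                    ∎
      where
      rest = sumTo (λ i → highCount (suc i)) N
      arith : ∀ x y s t → x + y + (s + t) ≡ x + s + (y + t)
      arith = solve-∀
      fits : suc N ≤ M * M / (2 + N)
      fits = begin
        suc N                        ≡⟨ m*n/n≡m (suc N) (2 + N) ⟨
        suc N * (2 + N) / (2 + N)    ≤⟨ /-monoˡ-≤ (2 + N) (*-mono-≤ (≤-trans N<p (m≤n+m p 2)) (s≤s (s≤s (<⇒≤ N<p)))) ⟩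
        M * M / (2 + N)              ∎

    -- The extreme terms `highCount 0 = M²` and `highCount (M - 1) = 1` are split off. The divisors
    -- that remain are `2, …, n - 3`, as needed for `log (n - 3)`.
    highTotal : sumTo highCount M + triangle p ≡ 1 + (M * M + quotients)
    highTotal = begin-equality
      highCount (suc p) + sumTo highCount (suc p) + triangle p  ≡⟨ cong (λ x → x + sumTo highCount (suc p) + triangle p) top ⟩
      1 + sumTo highCount (suc p) + triangle p                  ≡⟨ cong (λ x → 1 + x + triangle p) (trans (sumTo-shift highCount p) (cong (_+ rest) (n/1≡n (M * M)))) ⟩
      1 + (M * M + rest) + triangle p                           ≡⟨ cong suc (+-assoc (M * M) rest (triangle p)) ⟩
      1 + (M * M + (rest + triangle p))                         ≡⟨ cong (λ x → 1 + (M * M + x)) (highCount-triangle p ≤-refl) ⟩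
      1 + (M * M + quotients)                                         ∎
      where
      rest = sumTo (λ i → highCount (suc i)) p
      top : highCount (suc p) ≡ 1
      top = trans (cong (_∸ suc p) (m*n/n≡m M M)) (m+n∸n≡m 1 (suc p))

    -- The sum of squares formula; the added 6 supplies the missing square of `a = 1`.
    lowTotal : ∀ N → 6 * sumTo lowCount N + 6 ≡ (1 + N) * (2 + N) * (3 + 2 * N)
    lowTotal zero    = refl
    lowTotal (suc N) = begin-equality
      6 * (lowCount N + sumTo lowCount N) + 6           ≡⟨ arith (lowCount N) (sumTo lowCount N) ⟩
      6 * lowCount N + (6 * sumTo lowCount N + 6)       ≡⟨ cong (6 * lowCount N +_) (lowTotal N) ⟩
      6 * lowCount N + (1 + N) * (2 + N) * (3 + 2 * N)  ≡⟨ arith′ N ⟩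
      (2 + N) * (3 + N) * (3 + 2 * suc N)               ∎
      where
      arith : ∀ x y → 6 * (x + y) + 6 ≡ 6 * x + (6 * y + 6)
      arith = solve-∀
      arith′ : ∀ N → 6 * ((2 + N) * (2 + N)) + (1 + N) * (2 + N) * (3 + 2 * N) ≡ (2 + N) * (3 + N) * (3 + 2 * suc N)
      arith′ = solve-∀

    -- The upper bound multiplied by 3, with the negative terms moved to the left and
    -- `2 * quotients` in place of the logarithmic term.
    total-< : ∀ {l} (let n = 4 + p) → l ≤ codesTotal + codesTotal →
              3 * l + (6 * n * n + 18) < 2 * n * n * n + 16 * n + 3 * (2 * quotients)
    total-< {l} l≤ = +-cancelʳ-< (6 + 6 * t) _ _ (begin-strict
      3 * l + c + (6 + 6 * t)                     ≤⟨ +-monoˡ-≤ _ (+-monoˡ-≤ _ (*-monoʳ-≤ 3 l≤)) ⟩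
      3 * (s₀ + s₁ + (s₀ + s₁)) + c + (6 + 6 * t) ≡⟨ arith s₀ s₁ c t ⟩
      (6 * s₀ + 6) + 6 * (s₁ + t) + c             ≡⟨ cong₂ (λ x y → x + 6 * y + c) (lowTotal (suc p)) highTotal ⟩
      -- `24 + 6p` is exactly the slack between the two sides, and it makes the inequality strict.
      (2 + p) * (3 + p) * (3 + 2 * suc p) + 6 * (1 + (M * M + d)) + c               <⟨ m<m+n _ {24 + 6 * p} z<s ⟩
      (2 + p) * (3 + p) * (3 + 2 * suc p) + 6 * (1 + (M * M + d)) + c + (24 + 6 * p) ≡⟨ arith′ p d ⟩
      u + (6 + 3 * (p * suc p))                   ≡⟨ cong (λ x → u + (6 + 3 * x)) (2*triangle p) ⟨
      u + (6 + 3 * (2 * t))                       ≡⟨ cong (λ x → u + (6 + x)) (*-assoc 3 2 t) ⟨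
      u + (6 + 6 * t)                             ∎)
      where
      n = 4 + p
      t = triangle p
      d = quotients
      c = 6 * n * n + 18
      u = 2 * n * n * n + 16 * n + 3 * (2 * d)
      s₀ = sumTo lowCount (suc p)
      s₁ = sumTo highCount M
      arith : ∀ s₀ s₁ x t → 3 * (s₀ + s₁ + (s₀ + s₁)) + x + (6 + 6 * t) ≡ (6 * s₀ + 6) + 6 * (s₁ + t) + x
      arith = solve-∀
      arith′ : ∀ p d → (2 + p) * (3 + p) * (3 + 2 * suc p) + 6 * (1 + ((2 + p) * (2 + p) + d))
                         + (6 * (4 + p) * (4 + p) + 18) + (24 + 6 * p)
                     ≡ 2 * (4 + p) * (4 + p) * (4 + p) + 16 * (4 + p) + 3 * (2 * d) + (6 + 3 * (p * suc p))
      arith′ = solve-∀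

  -- Lower count: one structure for each orientation, small weight and folded residue

  module Lower (p : ℕ) where

    Coded : Vec ℕ (4 + p) × Vec ℕ (4 + p) → Bool × (ℕ × ℕ) → Set
    Coded dr (o , (i , j)) =
      Bident dr × ∃[ b ] (orient o (prongs dr) ≡ (2 + i , b) × 2 + i < b × fold i b ≡ suc j)

    -- The condition `a < b` tells the orientations apart; then `a` gives `i`, and `fold` gives `j`.
    coded-det : ∀ {dr c c′} → Coded dr c → Coded dr c′ → c ≡ c′
    coded-det {_ ∷ _ ∷ _ , _} {false , _} {false , _} (_ , _ , refl , _ , f) (_ , _ , refl , _ , f′)
      with refl ← trans (sym f) f′ = refl
    coded-det {_ ∷ _ ∷ _ , _} {true , _} {true , _} (_ , _ , refl , _ , f) (_ , _ , refl , _ , f′)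
      with refl ← trans (sym f) f′ = refl
    coded-det {_ ∷ _ ∷ _ , _} {false , _} {true , _} (_ , _ , refl , lt , _) (_ , _ , refl , lt′ , _) =
      contradiction lt′ (<-asym lt)
    coded-det {_ ∷ _ ∷ _ , _} {true , _} {false , _} (_ , _ , refl , lt , _) (_ , _ , refl , lt′ , _) =
      contradiction lt′ (<-asym lt)

    -- This is `a (a - 1) / 2`, so every folded residue `suc j` in range lies strictly below
    -- `a² / 2`.
    count : ℕ → ℕ
    count i = triangle (suc i)

    realise : ∀ {i j} o → j < count i → 2 * (2 + i) ≤ 4 + p → ∃[ dr ] Coded dr (o , (i , j))
    realise {i} {j} o j<count 2a≤n =
      let b , a<b , t , f = tail-exists {i} {j} small 2a≤n
          2≤a = s≤s (s≤s (z≤n {i}))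
          2≤b = ≤-trans 2≤a (<⇒≤ a<b)
      in oriented o (b , a<b , f , t , 2≤a , 2≤b)
      where
      small : 2 * suc j < (2 + i) * (2 + i)
      small = ≤-<-trans (*-monoʳ-≤ 2 j<count)
        (subst (_< (2 + i) * (2 + i)) (sym (2*triangle (suc i))) (*-monoˡ-< (2 + i) (n<1+n (suc i))))
      oriented : ∀ o → ∃[ b ] (2 + i < b × fold i b ≡ suc j × Tail (2 + i) b p × 2 ≤ 2 + i × 2 ≤ b) →
                 ∃[ dr ] Coded dr (o , (i , j))
      oriented false (b , a<b , f , t , 2≤a , 2≤b) =
        let dr , bd , e = tail⇒bident 2≤a 2≤b t in dr , bd , b , e , a<b , f
      oriented true (b , a<b , f , t , 2≤a , 2≤b) =
        let dr , bd , e = tail⇒bident 2≤b 2≤a (tail-sym t) in dr , bd , b , cong swap e , a<b , f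

    smooth-list : ∀ h → 2 * suc h ≤ 4 + p →
      ∃[ xs ] (Unique xs × All (IsSmoothArith (4 + p)) xs × length xs ≡ sumTo count h + sumTo count h)
    smooth-list h 2h≤n =
      let xs , xs! , coded , len = decode-list Coded (λ {dr} {c} {c′} → coded-det {dr} {c} {c′})
            (Unique.cartesianProduct⁺ (((λ ()) ∷ []) ∷ [] ∷ []) (grid-unique count h))
            (All.tabulate λ { {o , (i , j)} c∈ →
              let i<h , j<count = ∈-grid⁻ h (proj₂ (∈-cartesianProduct⁻ orientations (grid count h) c∈))
              in realise o j<count (≤-trans (*-monoʳ-≤ 2 (s≤s i<h)) 2h≤n) })
      in xs , xs! , All.map (λ { (_ , bd , _) → bident⇒smooth bd }) coded ,
         trans len (trans (length-oriented (grid count h)) (cong₂ _+_ (length-grid count h) (length-grid count h)))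

    countTotal : ∀ h → 3 * (sumTo count h + sumTo count h) ≡ h * (1 + h) * (2 + h)
    countTotal zero    = refl
    countTotal (suc h) = begin
      3 * (count h + s + (count h + s))                  ≡⟨ arith (count h) s ⟩
      3 * (2 * count h) + 3 * (s + s)                    ≡⟨ cong₂ (λ x y → 3 * x + y) (2*triangle (suc h)) (countTotal h) ⟩
      3 * (suc h * suc (suc h)) + h * (1 + h) * (2 + h)  ≡⟨ arith′ h ⟩
      suc h * (2 + h) * (3 + h)                          ∎
      where
      open ≡-Reasoning
      s = sumTo count h
      arith : ∀ c s → 3 * (c + s + (c + s)) ≡ 3 * (2 * c) + 3 * (s + s)
      arith = solve-∀
      arith′ : ∀ h → 3 * (suc h * suc (suc h)) + h * (1 + h) * (2 + h) ≡ suc h * (2 + h) * (3 + h)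
      arith′ = solve-∀

  -- Comparing the lower count with the cubic polynomial

  parity : ∀ p → ∃[ q ] (p ≡ 2 * q ⊎ p ≡ 1 + 2 * q)
  parity zero = 0 , inj₁ refl
  parity (suc p) with parity p
  ... | q , inj₁ refl = q , inj₂ refl
  ... | q , inj₂ refl = suc q , inj₁ (sym (*-suc 2 q))

  -- Here `2 + q` is `n / 2` rounded down. Thus `24 l` is `(n - 2) n (n + 2)` for even `n` and
  -- `(n - 3)(n - 1)(n + 1) = n³ - 3n² - n + 3` for odd `n`.
  cubic-bound : ∀ p → ∃[ q ] (2 * (2 + q) ≤ 4 + p ×
    (∀ l (let n = 4 + p) → 3 * l ≡ (1 + q) * (2 + q) * (3 + q) →
      n * n * n ≤ 24 * l + 3 * n * n + n + 45))
  cubic-bound p with parity p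
  ... | q , inj₁ refl = q , ≤-reflexive (*-distribˡ-+ 2 2 q) , λ l e → begin
    n * n * n                                               ≤⟨ m≤m+n _ (12 * q * q + 42 * q + 81) ⟩
    n * n * n + (12 * q * q + 42 * q + 81)                  ≡⟨ arith q ⟩
    8 * ((1 + q) * (2 + q) * (3 + q)) + 3 * n * n + n + 45  ≡⟨ cong (λ x → 8 * x + 3 * n * n + n + 45) e ⟨
    8 * (3 * l) + 3 * n * n + n + 45                        ≡⟨ cong (λ x → x + 3 * n * n + n + 45) (*-assoc 8 3 l) ⟨
    24 * l + 3 * n * n + n + 45                             ∎
    where
    open ≤-Reasoning
    n = 4 + 2 * q
    arith : ∀ q → (4 + 2 * q) * (4 + 2 * q) * (4 + 2 * q) + (12 * q * q + 42 * q + 81) ≡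
      8 * ((1 + q) * (2 + q) * (3 + q)) + 3 * (4 + 2 * q) * (4 + 2 * q) + (4 + 2 * q) + 45
    arith = solve-∀
  ... | q , inj₂ refl = q , ≤-trans (≤-reflexive (*-distribˡ-+ 2 2 q)) (n≤1+n _) , λ l e → begin
    n * n * n                                               ≤⟨ m≤m+n _ 48 ⟩
    n * n * n + 48                                          ≡⟨ arith q ⟩
    8 * ((1 + q) * (2 + q) * (3 + q)) + 3 * n * n + n + 45  ≡⟨ cong (λ x → 8 * x + 3 * n * n + n + 45) e ⟨
    8 * (3 * l) + 3 * n * n + n + 45                        ≡⟨ cong (λ x → x + 3 * n * n + n + 45) (*-assoc 8 3 l) ⟨
    24 * l + 3 * n * n + n + 45                             ∎
    where
    open ≤-Reasoning
    n = 5 + 2 * q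
    arith : ∀ q → (5 + 2 * q) * (5 + 2 * q) * (5 + 2 * q) + 48 ≡
      8 * ((1 + q) * (2 + q) * (3 + q)) + 3 * (5 + 2 * q) * (5 + 2 * q) + (5 + 2 * q) + 45
    arith = solve-∀

open Counting
open import Data.Integer as ℤ using (+_)
import Data.Integer.Properties as ℤₚ
import Data.Integer.Tactic.RingSolver as ℤ-Solver
open import Data.Rational.Unnormalised using (_/_; _+_; _*_; _<_; *≤*; *<*) renaming (_≤_ to _≤ᵘ_)
import Data.Rational.Unnormalised.Properties as ℚₚ

-- Rational arithmetic

-- The unreduced numerators below are those to which ℚᵘ arithmetic evaluates.
lowerBound-≤ : ∀ n k → n ℕ.* n ℕ.* n ≤ 24 ℕ.* k ℕ.+ 3 ℕ.* n ℕ.* n ℕ.+ n ℕ.+ 45 → lowerBound n ≤ᵘ ℕ→ℚ k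
lowerBound-≤ n k le = *≤* (bound (+ n) (+ k) (subst₂ ℤ._≤_ cube quadratic (ℤ.+≤+ le)))
  where
  cube : + (n ℕ.* n ℕ.* n) ≡ + n ℤ.* + n ℤ.* + n
  cube = trans (ℤₚ.pos-* (n ℕ.* n) n) (cong (ℤ._* + n) (ℤₚ.pos-* n n))
  quadratic : + (24 ℕ.* k ℕ.+ 3 ℕ.* n ℕ.* n ℕ.+ n ℕ.+ 45) ≡ + 24 ℤ.* + k ℤ.+ + 3 ℤ.* + n ℤ.* + n ℤ.+ + n ℤ.+ + 45
  quadratic = cong (λ z → z ℤ.+ + n ℤ.+ + 45) (cong₂ ℤ._+_ (ℤₚ.pos-* 24 k)
    (trans (ℤₚ.pos-* (3 ℕ.* n) n) (cong (ℤ._* + n) (ℤₚ.pos-* 3 n))))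
  bound : ∀ x y → x ℤ.* x ℤ.* x ℤ.≤ + 24 ℤ.* y ℤ.+ + 3 ℤ.* x ℤ.* x ℤ.+ x ℤ.+ + 45 →
          + 1 ℤ.* (((x ℤ.* x ℤ.* x ℤ.* + 1 ℤ.+ ℤ.- (+ 3 ℤ.* x ℤ.* x) ℤ.* + 1) ℤ.* + 1 ℤ.+ ℤ.- x ℤ.* + 1) ℤ.* + 1
            ℤ.+ ℤ.- (+ 45) ℤ.* + 1) ℤ.* + 1 ℤ.≤ y ℤ.* + 24
  bound x y le = subst₂ ℤ._≤_ (lhs x) (rhs x y) (ℤₚ.+-monoˡ-≤ (ℤ.- (+ 3 ℤ.* x ℤ.* x ℤ.+ x ℤ.+ + 45)) le)
    where
    lhs : ∀ x → x ℤ.* x ℤ.* x ℤ.+ ℤ.- (+ 3 ℤ.* x ℤ.* x ℤ.+ x ℤ.+ + 45) ≡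
      + 1 ℤ.* (((x ℤ.* x ℤ.* x ℤ.* + 1 ℤ.+ ℤ.- (+ 3 ℤ.* x ℤ.* x) ℤ.* + 1) ℤ.* + 1 ℤ.+ ℤ.- x ℤ.* + 1) ℤ.* + 1
        ℤ.+ ℤ.- (+ 45) ℤ.* + 1) ℤ.* + 1
    lhs = ℤ-Solver.solve-∀
    rhs : ∀ x y → + 24 ℤ.* y ℤ.+ + 3 ℤ.* x ℤ.* x ℤ.+ x ℤ.+ + 45 ℤ.+ ℤ.- (+ 3 ℤ.* x ℤ.* x ℤ.+ x ℤ.+ + 45) ≡ y ℤ.* + 24
    rhs = ℤ-Solver.solve-∀

<-upperPoly : ∀ n l e → 3 ℕ.* l ℕ.+ (6 ℕ.* n ℕ.* n ℕ.+ 18) ℕ.< 2 ℕ.* n ℕ.* n ℕ.* n ℕ.+ 16 ℕ.* n ℕ.+ 3 ℕ.* e →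
              ℕ→ℚ l < upperPoly n + ℕ→ℚ e
<-upperPoly n l e lt = *<* (bound (+ n) (+ l) (+ e) (subst₂ ℤ._<_ lhs rhs (ℤ.+<+ lt)))
  where
  lhs : + (3 ℕ.* l ℕ.+ (6 ℕ.* n ℕ.* n ℕ.+ 18)) ≡ + 3 ℤ.* + l ℤ.+ (+ 6 ℤ.* + n ℤ.* + n ℤ.+ + 18)
  lhs = cong₂ (λ u v → u ℤ.+ (v ℤ.+ + 18)) (ℤₚ.pos-* 3 l)
    (trans (ℤₚ.pos-* (6 ℕ.* n) n) (cong (ℤ._* + n) (ℤₚ.pos-* 6 n)))
  rhs : + (2 ℕ.* n ℕ.* n ℕ.* n ℕ.+ 16 ℕ.* n ℕ.+ 3 ℕ.* e) ≡ + 2 ℤ.* + n ℤ.* + n ℤ.* + n ℤ.+ + 16 ℤ.* + n ℤ.+ + 3 ℤ.* + e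
  rhs = cong₂ ℤ._+_ (cong₂ ℤ._+_
    (trans (ℤₚ.pos-* (2 ℕ.* n ℕ.* n) n) (cong (ℤ._* + n) (trans (ℤₚ.pos-* (2 ℕ.* n) n) (cong (ℤ._* + n) (ℤₚ.pos-* 2 n)))))
    (ℤₚ.pos-* 16 n)) (ℤₚ.pos-* 3 e)
  bound : ∀ x y z → + 3 ℤ.* y ℤ.+ (+ 6 ℤ.* x ℤ.* x ℤ.+ + 18) ℤ.< + 2 ℤ.* x ℤ.* x ℤ.* x ℤ.+ + 16 ℤ.* x ℤ.+ + 3 ℤ.* z →
    y ℤ.* + 9 ℤ.<
    ((((+ 2 ℤ.* x ℤ.* x ℤ.* x ℤ.* + 1 ℤ.+ ℤ.- (+ 2 ℤ.* x ℤ.* x) ℤ.* + 3) ℤ.* + 3 ℤ.+ + 16 ℤ.* x ℤ.* + 3) ℤ.* + 1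
      ℤ.+ ℤ.- (+ 6) ℤ.* + 9) ℤ.* + 1 ℤ.+ z ℤ.* + 9) ℤ.* + 1
  -- The two denominators 3 multiply to 9 without reduction, hence the further factor 3.
  bound x y z lt = subst₂ ℤ._<_ (lhs′ x y) (rhs′ x z)
    (ℤₚ.*-monoˡ-<-pos (+ 3) (ℤₚ.+-monoˡ-< (ℤ.- (+ 6 ℤ.* x ℤ.* x ℤ.+ + 18)) lt))
    where
    lhs′ : ∀ x y → + 3 ℤ.* (+ 3 ℤ.* y ℤ.+ (+ 6 ℤ.* x ℤ.* x ℤ.+ + 18) ℤ.+ ℤ.- (+ 6 ℤ.* x ℤ.* x ℤ.+ + 18)) ≡ y ℤ.* + 9
    lhs′ = ℤ-Solver.solve-∀
    rhs′ : ∀ x z → + 3 ℤ.* (+ 2 ℤ.* x ℤ.* x ℤ.* x ℤ.+ + 16 ℤ.* x ℤ.+ + 3 ℤ.* z ℤ.+ ℤ.- (+ 6 ℤ.* x ℤ.* x ℤ.+ + 18)) ≡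
      ((((+ 2 ℤ.* x ℤ.* x ℤ.* x ℤ.* + 1 ℤ.+ ℤ.- (+ 2 ℤ.* x ℤ.* x) ℤ.* + 3) ℤ.* + 3 ℤ.+ + 16 ℤ.* x ℤ.* + 3) ℤ.* + 1
        ℤ.+ ℤ.- (+ 6) ℤ.* + 9) ℤ.* + 1 ℤ.+ z ℤ.* + 9) ℤ.* + 1
    rhs′ = ℤ-Solver.solve-∀

-- Comparing the quotient sum with the logarithm

upperLogCoeff≡ : ∀ n → upperLogCoeff (suc n) ≡ ℕ→ℚ (2 ℕ.* n ℕ.* n)
upperLogCoeff≡ n = cong (_/ 1) (trans (coeff (+ n)) (sym (trans (ℤₚ.pos-* (2 ℕ.* n) n) (cong (ℤ._* + n) (ℤₚ.pos-* 2 n)))))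
  where
  coeff : ∀ x → (+ 2 ℤ.* (+ 1 ℤ.+ x) ℤ.* (+ 1 ℤ.+ x) ℤ.* + 1 ℤ.+ ℤ.- (+ 4 ℤ.* (+ 1 ℤ.+ x)) ℤ.* + 1) ℤ.* + 1 ℤ.+ + 2 ℤ.* + 1
              ≡ + 2 ℤ.* x ℤ.* x
  coeff = ℤ-Solver.solve-∀

-- The fraction is `1 / (2 + j)` in unreduced form, so dropping the rounding on the left suffices.
quotient-≤-logTerm : ∀ k c m j → 2 ℕ.* m ≤ c →
  ℕ→ℚ (2 ℕ.* (m ℕ./ (2 ℕ.+ j))) ≤ᵘ ℕ→ℚ c * (+ suc k / (suc k ℕ.+ suc j ℕ.* suc k))
quotient-≤-logTerm k c m j c≥ = *≤* (subst₂ ℤ._≤_ (ℤₚ.pos-* (2 ℕ.* q) _)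
  (trans (ℤₚ.pos-* (c ℕ.* suc k) 1) (cong (ℤ._* + 1) (ℤₚ.pos-* c (suc k)))) (ℤ.+≤+ le))
  where
  open ℕₚ.≤-Reasoning
  q = m ℕ./ (2 ℕ.+ j)
  arith : ∀ q j s → 2 ℕ.* q ℕ.* (1 ℕ.* (s ℕ.+ suc j ℕ.* s)) ≡ 2 ℕ.* (q ℕ.* (2 ℕ.+ j)) ℕ.* s
  arith = solve-∀
  le : 2 ℕ.* q ℕ.* (1 ℕ.* (suc k ℕ.+ suc j ℕ.* suc k)) ≤ c ℕ.* suc k ℕ.* 1
  le = begin
    2 ℕ.* q ℕ.* (1 ℕ.* (suc k ℕ.+ suc j ℕ.* suc k))  ≡⟨ arith q j (suc k) ⟩
    2 ℕ.* (q ℕ.* (2 ℕ.+ j)) ℕ.* suc k                ≤⟨ ℕₚ.*-monoˡ-≤ (suc k) (ℕₚ.*-monoʳ-≤ 2 (m/n*n≤m m (2 ℕ.+ j))) ⟩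
    2 ℕ.* m ℕ.* suc k                                ≤⟨ ℕₚ.*-monoˡ-≤ (suc k) c≥ ⟩
    c ℕ.* suc k                                      ≡⟨ ℕₚ.*-identityʳ _ ⟨
    c ℕ.* suc k ℕ.* 1                                ∎

-- With k + 1 pieces on [1, k + 2] the lower Riemann sum of 1/t is exactly 1/2 + ⋯ + 1/(k + 2).
quotientSum-≤-logLowerSumAux : ∀ k c m J → 2 ℕ.* m ≤ c →
  ℕ→ℚ (2 ℕ.* quotientSum m J) ≤ᵘ ℕ→ℚ c * logLowerSumAux (2 ℕ.+ k) k J
quotientSum-≤-logLowerSumAux k c m zero    _  = ℚₚ.≤-reflexive (ℚₚ.≃-sym (ℚₚ.*-zeroʳ (ℕ→ℚ c)))
quotientSum-≤-logLowerSumAux k c m (suc J) c≥ = begin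
  ℕ→ℚ (2 ℕ.* (q ℕ.+ s))             ≡⟨ cong (λ x → ℕ→ℚ x) (arith q s) ⟩
  ℕ→ℚ (2 ℕ.* s ℕ.+ 2 ℕ.* q)         ≡⟨ ℕ→ℚ-+ (2 ℕ.* s) (2 ℕ.* q) ⟩
  ℕ→ℚ (2 ℕ.* s) + ℕ→ℚ (2 ℕ.* q)     ≤⟨ ℚₚ.+-mono-≤ (quotientSum-≤-logLowerSumAux k c m J c≥) (quotient-≤-logTerm k c m J c≥) ⟩
  ℕ→ℚ c * logSum + ℕ→ℚ c * logTerm  ≃⟨ ℚₚ.*-distribˡ-+ (ℕ→ℚ c) logSum logTerm ⟨
  ℕ→ℚ c * (logSum + logTerm)        ∎
  where
  open ℚₚ.≤-Reasoning
  q = m ℕ./ (2 ℕ.+ J)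
  s = quotientSum m J
  logSum = logLowerSumAux (2 ℕ.+ k) k J
  logTerm = + suc k / (suc k ℕ.+ suc J ℕ.* suc k)
  arith : ∀ q s → 2 ℕ.* (q ℕ.+ s) ≡ 2 ℕ.* s ℕ.+ 2 ℕ.* q
  arith = solve-∀
  ℕ→ℚ-+ : ∀ i j → ℕ→ℚ (i ℕ.+ j) ≡ ℕ→ℚ i + ℕ→ℚ j
  ℕ→ℚ-+ i j = cong (_/ 1) (sym (cong₂ ℤ._+_ (ℤₚ.*-identityʳ (+ i)) (ℤₚ.*-identityʳ (+ j))))

quotients-≤-log : ∀ p → ∃[ k ] (ℕ→ℚ (2 ℕ.* Upper.quotients p) ≤ᵘ upperLogCoeff (4 ℕ.+ p) * logLowerSum (suc p) k)
-- For `n = 4` there are no quotients, and the interval `[1, 1]` gives the value 0.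
quotients-≤-log zero    = 0 , *≤* (ℤ.+≤+ z≤n)
quotients-≤-log (suc k) = k ,
  subst (λ c → ℕ→ℚ (2 ℕ.* Upper.quotients (suc k)) ≤ᵘ c * logLowerSum (2 ℕ.+ k) k) (sym (upperLogCoeff≡ (4 ℕ.+ k)))
    (quotientSum-≤-logLowerSumAux k (2 ℕ.* (4 ℕ.+ k) ℕ.* (4 ℕ.+ k)) ((3 ℕ.+ k) ℕ.* (3 ℕ.+ k)) (suc k) c≥)
  where
  -- The log coefficient is `2 (n - 1)²`, while the quotients have numerator `(n - 2)²`.
  c≥ : 2 ℕ.* ((3 ℕ.+ k) ℕ.* (3 ℕ.+ k)) ≤ 2 ℕ.* (4 ℕ.+ k) ℕ.* (4 ℕ.+ k)
  c≥ = ℕₚ.≤-trans (ℕₚ.*-monoʳ-≤ 2 (ℕₚ.*-mono-≤ (ℕₚ.n≤1+n (3 ℕ.+ k)) (ℕₚ.n≤1+n (3 ℕ.+ k))))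
    (ℕₚ.≤-reflexive (sym (ℕₚ.*-assoc 2 (4 ℕ.+ k) (4 ℕ.+ k))))

-- Cardinality is expressed by duplicate-free lists: one of them reaches the lower bound, and all of
-- them obey the upper bound. A single `k` suffices because lower Riemann sums never exceed the
-- logarithm.
theorem4p1 : (n : ℕ) → 4 ≤ n →
    (∃[ xs ] (Unique {A = Vec ℕ n × Vec ℕ n} xs × All (IsSmoothArith n) xs
    × lowerBound n ≤ᵘ ℕ→ℚ (length xs)))
    × ((xs : List (Vec ℕ n × Vec ℕ n)) → Unique xs → All (IsSmoothArith n) xs →
    ∃[ k ] (ℕ→ℚ (length xs) < upperPoly n + upperLogCoeff n * logLowerSum (n ∸ 3) k))
theorem4p1 (suc (suc (suc (suc p)))) (s≤s (s≤s (s≤s (s≤s _)))) =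
  -- The list uses `suc q` values of `a`, from 2 to `2 + q`.
  (let q , 2a≤n , cubic = cubic-bound p
       xs , xs! , smooth , len = Lower.smooth-list p (suc q) 2a≤n
   in  xs , xs! , smooth , lowerBound-≤ (4 ℕ.+ p) (length xs)
         (cubic (length xs) (trans (cong (3 ℕ.*_) len) (Lower.countTotal p (suc q))))) ,
  λ xs xs! smooth →
    let k , log = quotients-≤-log p
    in  k , ℚₚ.<-≤-trans
          (<-upperPoly (4 ℕ.+ p) (length xs) (2 ℕ.* Upper.quotients p)
            (Upper.total-< p (Upper.length-smooth-≤ p xs! smooth)))
          (ℚₚ.+-monoʳ-≤ (upperPoly (4 ℕ.+ p)) log)
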